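{- There is an absolute constant $c>0$ such that the following holds. Let $n$ be a power of $2$ and let $f:[n]^d\to\{0,1\}$ be $\varepsilon$-far from being monotone. Let $r$ be the minimum, over all maximal matchings $M$ in the violation graph of $f$, of the average distance $\frac{1}{|M|}\sum_{(x,y)\in M} d_{\mathbf{A}}(x,y)$. Then $I^-_f\ge c\, r\,\varepsilon$.
   Context: $[n]^d$ is partially ordered coordinatewise ($x\prec y$ iff $x\preceq y$ and $x\neq y$); $f$ is monotone if $f(x)\le f(y)$ whenever $x\preceq y$, and $\varepsilon$-far from monotone if it differs from every monotone function on at least $\varepsilon n^d$ points. The violation graph of $f$ has an edge (violated pair) $(x,y)$ whenever $x\prec y$, $f(x)=1$, $f(y)=0$; a matching is a set of vertex-disjoint violated pairs, maximal with respect to inclusion. The augmented hypergrid $\mathbf{A}_{n,d}$ is the directed graph on $[n]^d$ with an edge $(x,y)$ whenever $x,y$ differ in exactly one coordinate $i$ and $y_i-x_i=2^a$ for some integer $a\ge0$; $d_{\mathbf{A}}(x,y)$ is the directed shortest-path distance in $\mathbf{A}_{n,d}$. $S^-_f$ is the set of edges $(x,y)$ of $\mathbf{A}_{n,d}$ with $f(x)=1,f(y)=0$, and $I^-_f:=|S^-_f|/n^d$. -}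

module Defs where

open import Data.Nat as ℕ using (ℕ; zero; suc; _^_; _≤_)
open import Data.Fin using (Fin; toℕ)
open import Data.Vec using (Vec; lookup)
open import Data.Bool using (Bool; true; false) renaming (_≤_ to _≤ᵇ_)
open import Data.List using (List; []; _∷_; length; concatMap)
open import Data.Nat.ListAction using (sum)
open import Data.List.Membership.Propositional using (_∈_)
open import Data.List.Relation.Unary.Unique.Propositional using (Unique)
open import Data.List.Relation.Unary.Any using (Any)
open import Data.List.Relation.Binary.Pointwise using (Pointwise)
open import Data.Product using (Σ; ∃; ∃-syntax; _×_; _,_)
open import Data.Sum using (_⊎_)
open import Data.Integer using (+_)
open import Data.Rational as ℚ using (ℚ; _/_)
open import Relation.Binary.PropositionalEquality using (_≡_; _≢_)
open import Relation.Nullary using (¬_)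

Point : ℕ → ℕ → Set
Point n d = Vec (Fin n) d

_⪯_ : ∀ {n d} → Point n d → Point n d → Set
x ⪯ y = ∀ i → toℕ (lookup x i) ≤ toℕ (lookup y i)

_≺_ : ∀ {n d} → Point n d → Point n d → Set
x ≺ y = x ⪯ y × x ≢ y

Monotone : ∀ {n d} → (Point n d → Bool) → Set
Monotone g = ∀ x y → x ⪯ y → g x ≤ᵇ g y

HasSize : {A : Set} → (A → Set) → ℕ → Set
HasSize {A} P k = Σ (List A) λ xs → Unique xs × (∀ a → a ∈ xs → P a) × (∀ a → P a → a ∈ xs) × length xs ≡ k

toℚ : ℕ → ℚ
toℚ k = (+ k) / 1

Far : ∀ {n d} → ℚ → (Point n d → Bool) → Set
Far {n} {d} ε f = ∀ g → Monotone g → ∀ k → HasSize (λ x → f x ≢ g x) k → ε ℚ.* toℚ (n ^ d) ℚ.≤ toℚ k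

Violated : ∀ {n d} → (Point n d → Bool) → Point n d → Point n d → Set
Violated f x y = x ≺ y × f x ≡ true × f y ≡ false

Pair : ℕ → ℕ → Set
Pair n d = Point n d × Point n d

endpoints : ∀ {n d} → List (Pair n d) → List (Point n d)
endpoints = concatMap (λ { (x , y) → x ∷ y ∷ [] })

MaximalMatching : ∀ {n d} → (Point n d → Bool) → List (Pair n d) → Set
MaximalMatching f M =
  (∀ p → p ∈ M → Violated f (Data.Product.proj₁ p) (Data.Product.proj₂ p)) ×
  Unique (endpoints M) ×
  (∀ x y → Violated f x y → Any (λ { (u , v) → x ≡ u ⊎ x ≡ v ⊎ y ≡ u ⊎ y ≡ v }) M)

AEdge : ∀ {n d} → Point n d → Point n d → Set
AEdge x y = ∃[ i ] ∃[ a ] (toℕ (lookup y i) ≡ toℕ (lookup x i) ℕ.+ 2 ^ a) ×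
            (∀ j → j ≢ i → lookup x j ≡ lookup y j)

data Walk {n d : ℕ} : ℕ → Point n d → Point n d → Set where
  here : ∀ {x} → Walk zero x x
  step : ∀ {k x y z} → AEdge x y → Walk k y z → Walk (suc k) x z

IsDistA : ∀ {n d} → Point n d → Point n d → ℕ → Set
IsDistA x y k = Walk k x y × (∀ m → Walk m x y → k ≤ m)

AvgDist : ∀ {n d} → List (Pair n d) → ℚ → Set
AvgDist M q = 1 ≤ length M × Σ (List ℕ) λ ds →
  Pointwise (λ p k → IsDistA (Data.Product.proj₁ p) (Data.Product.proj₂ p) k) M ds ×
  q ℚ.* toℚ (length M) ≡ toℚ (sum ds)

IsMinAvgDist : ∀ {n d} → (Point n d → Bool) → ℚ → Set
IsMinAvgDist f r =
  (∃[ M ] MaximalMatching f M × AvgDist M r) ×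
  (∀ M q → MaximalMatching f M → AvgDist M q → r ℚ.≤ q)

InSminus : ∀ {n d} → (Point n d → Bool) → Pair n d → Set
InSminus f (x , y) = AEdge x y × f x ≡ true × f y ≡ false

PowerOfTwo : ℕ → Set
PowerOfTwo n = ∃[ k ] n ≡ 2 ^ k

{-# OPTIONS --safe #-}
module Submission where

-- The distance d_A(x, y) is the total number of binary ones in the differences
-- yᵢ − xᵢ. Let M be a maximum-weight matching of the violation graph for the weight
-- B − d_A with B larger than every distance; M is maximal, and it comes with an
-- optimal dual pair (α, β). Fix a direction i and an exponent a and write x⁺ for x
-- shifted by 2 ^ a. If bit a of yᵢ − xᵢ is set for (x, y) ∈ M, then (x⁺, y) is closer
-- by one, so either (x, x⁺) is a violated edge or α x < α x⁺. In the latter case x⁺ is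
-- matched, to z⁺ say, and duality makes (z, z⁺) violated or gives β z⁺ < β z; then z
-- is matched, to u say, and (u, u⁺) is violated or α u < α u⁺; and so on. These steps
-- are injective and never arrive at a matched pair with bit a set, so the set bits
-- number at most twice the violated edges. Summing over i and a, the total length of
-- M is at most 2 |S⁻|. The endpoints of M form a vertex cover of the violation graph,
-- so ε n^d ≤ 2 |M|, and c = 1/4 works.

open import Defs
open import Data.Nat
open import Data.Nat.Properties
open import Data.Nat.DivMod
open import Data.Nat.Divisibility
open import Data.Nat.ListAction using (sum)
open import Data.Nat.ListAction.Properties using (sum-++)
open import Algebra.Properties.CommutativeSemigroup +-commutativeSemigroup using (xy∙z≈zy∙x)
open import Data.Bool as Bool using (Bool; true; false; b≤b; f≤t)
open import Data.Empty using (⊥; ⊥-elim)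
open import Data.Fin as Fin using (Fin; toℕ; fromℕ<) renaming (zero to fzero; suc to fsuc)
import Data.Fin.Properties as Fin
open import Data.Integer as ℤ using (+≤+)
import Data.Integer.Properties as ℤ
open import Data.List using (List; []; _∷_; _++_; length; map; filter; foldr; tabulate; applyUpTo; upTo; allFin; cartesianProduct; cartesianProductWith)
open import Data.List.Properties using (length-++; length-++-sucʳ; length-map; length-upTo; filter-++; map-++; map-∘; map-cong; map-tabulate; map-applyUpTo)
open import Data.List.Membership.Propositional using (_∈_; _∉_; find; lose)
open import Data.List.Membership.Propositional.Properties
import Data.List.Membership.DecPropositional as DecMembership
open import Data.List.Relation.Binary.Pointwise using (Pointwise; []; _∷_)
open import Data.List.Relation.Unary.All as All using (All; []; _∷_)
open import Data.List.Relation.Unary.All.Properties using (¬All⇒Any¬)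
open import Data.List.Relation.Unary.AllPairs using ([]; _∷_)
open import Data.List.Relation.Unary.Any as Any using (Any; here; there)
open import Data.List.Relation.Unary.Unique.Propositional using (Unique)
import Data.List.Relation.Unary.Unique.Propositional.Properties as Uniq
open import Data.Maybe using (Maybe; just; nothing)
open import Data.Maybe.Properties using (just-injective) renaming (≡-dec to ≡-decᴹ)
open import Data.Product using (Σ; ∃; ∃₂; ∃-syntax; _×_; _,_; proj₁; proj₂)
open import Data.Rational as ℚ using (ℚ; 0ℚ; 1ℚ; ½)
import Data.Rational.Properties as ℚ
open import Data.Rational.Solver using (module +-*-Solver)
import Data.Rational.Unnormalised as ℚᵘ
import Data.Rational.Unnormalised.Properties as ℚᵘ
open import Data.Sum using (_⊎_; inj₁; inj₂)
open import Data.Sum.Properties using (inj₁-injective; inj₂-injective)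
open import Data.Vec using (Vec; []; _∷_; lookup; _[_]≔_)
import Data.Vec.Properties as Vec
open import Function using (_∘_; id)
open import Relation.Binary.Definitions using (DecidableEquality)
open import Relation.Binary.PropositionalEquality hiding ([_])
open import Relation.Nullary using (¬_; Dec; yes; no; does; contradiction; ¬?; decidable-stable)
open import Relation.Nullary.Decidable using (_×-dec_; _→-dec_; map′; dec-true; dec-false)
open import Relation.Unary using (Decidable)

-- Maximum-weight bipartite matchings and their duals

private variable
  A B : Set

-- Counting through a relation lets each use exhibit a partner without building a choice function.
-- The partner `y` of the head is deleted from `ys`; by injectivity no later element has `y` as its
-- partner, so the induction continues on `ls ++ rs`.
length-≤-of-injective : (R : A → B → Set) {xs : List A} {ys : List B} → Unique xs →
  (∀ {x} → x ∈ xs → ∃ λ y → y ∈ ys × R x y) →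
  (∀ {x x′ y} → x ∈ xs → x′ ∈ xs → R x y → R x′ y → x ≡ x′) →
  length xs ≤ length ys
length-≤-of-injective R [] total inj = z≤n
length-≤-of-injective R {x ∷ xs} {ys} (x∉xs ∷ uniq) total inj
  with y , y∈ys , Rxy ← total (here refl)
  with ls , rs , refl ← ∈-∃++ y∈ys = begin
    suc (length xs)          ≤⟨ s≤s (length-≤-of-injective R uniq total′ (λ p q → inj (there p) (there q))) ⟩
    suc (length (ls ++ rs))  ≡⟨ length-++-sucʳ ls y rs ⟨
    length (ls ++ y ∷ rs)    ∎
  where
  open ≤-Reasoning
  total′ : ∀ {z} → z ∈ xs → ∃ λ y → y ∈ ls ++ rs × R z y
  total′ z∈xs with y′ , y′∈ , Rzy′ ← total (there z∈xs) with ∈-++⁻ ls y′∈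
  ... | inj₁ y′∈ls         = y′ , ∈-++⁺ˡ y′∈ls , Rzy′
  ... | inj₂ (there y′∈rs) = y′ , ∈-++⁺ʳ ls y′∈rs , Rzy′
  ... | inj₂ (here refl)   = contradiction (inj (here refl) (there z∈xs) Rxy Rzy′) (All.lookup x∉xs z∈xs)

length-≤-of-⊆ : {xs ys : List A} → Unique xs → (∀ {x} → x ∈ xs → x ∈ ys) → length xs ≤ length ys
length-≤-of-⊆ uniq sub = length-≤-of-injective _≡_ uniq (λ x∈ → _ , sub x∈ , refl) (λ _ _ p q → trans p (sym q))

sum-map-mono : (g h : A → ℕ) → (∀ x → g x ≤ h x) → ∀ xs → sum (map g xs) ≤ sum (map h xs)
sum-map-mono g h g≤h []       = z≤n
sum-map-mono g h g≤h (x ∷ xs) = +-mono-≤ (g≤h x) (sum-map-mono g h g≤h xs)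

sum-map-strict : (g h : A → ℕ) → (∀ x → g x ≤ h x) → ∀ {x xs} → x ∈ xs → g x < h x →
  sum (map g xs) < sum (map h xs)
sum-map-strict g h g≤h {xs = _ ∷ xs} (here refl) g<h = +-mono-<-≤ g<h (sum-map-mono g h g≤h xs)
sum-map-strict g h g≤h {xs = z ∷ xs} (there x∈) g<h  = +-mono-≤-< (g≤h z) (sum-map-strict g h g≤h x∈ g<h)

maximum : (A → ℕ) → List A → ℕ
maximum g = foldr (λ x m → g x ⊔ m) 0

≤-maximum : (g : A → ℕ) → ∀ {x xs} → x ∈ xs → g x ≤ maximum g xs
≤-maximum g {xs = x ∷ xs} (here refl) = m≤m⊔n (g x) _
≤-maximum g {xs = z ∷ xs} (there x∈)  = ≤-trans (≤-maximum g x∈) (m≤n⊔m (g z) _)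

maximum-≤ : (g : A → ℕ) → ∀ {b} → (∀ x → g x ≤ b) → ∀ xs → maximum g xs ≤ b
maximum-≤ g g≤b []       = z≤n
maximum-≤ g g≤b (x ∷ xs) = ⊔-lub (g≤b x) (maximum-≤ g g≤b xs)

maximum-attained : (g : A → ℕ) → ∀ xs → 0 < maximum g xs → ∃ λ x → g x ≡ maximum g xs
maximum-attained g (x ∷ xs) 0<m with ≤-total (g x) (maximum g xs)
... | inj₂ m≤g = x , sym (m≥n⇒m⊔n≡m m≤g)
... | inj₁ g≤m with y , eq ← maximum-attained g xs (subst (0 <_) (m≤n⇒m⊔n≡n g≤m) 0<m) =
  y , trans eq (sym (m≤n⇒m⊔n≡n g≤m))

module WeightedMatching {V : Set} (_≟ᵛ_ : DecidableEquality V)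
  (pts : List V) (complete : ∀ v → v ∈ pts) where

  _[_↦_] : (V → A) → V → A → V → A
  (h [ v ↦ a ]) z with z ≟ᵛ v
  ... | yes _ = a
  ... | no  _ = h z

  update-same : (h : V → A) (v : V) (a : A) → (h [ v ↦ a ]) v ≡ a
  update-same h v a with v ≟ᵛ v
  ... | yes _  = refl
  ... | no v≢v = contradiction refl v≢v

  Injective : (V → Maybe V) → Set
  Injective m = ∀ {x y z} → m y ≡ just x → m z ≡ just x → y ≡ z

  matched? : ∀ (m : V → Maybe V) x → Dec (Any (λ y → m y ≡ just x) pts)
  matched? m x = Any.any? (λ y → ≡-decᴹ _≟ᵛ_ (m y) (just x)) pts

  -- Prices β of an auction in which every bid raises a price by one: an owner's
  -- surplus w x y - β y is within one of the best surplus available to it.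
  record AuctionState (w : V → V → ℕ) : Set where
    field
      m        : V → Maybe V
      β        : V → ℕ
      m-inj    : Injective m
      owned    : ∀ {x y} → m y ≡ just x → 0 < β y × β y ≤ w x y
      unowned  : ∀ {y} → m y ≡ nothing → β y ≡ 0
      content  : ∀ {x y} → m y ≡ just x → ∀ z → w x z + β y ≤ suc (w x y + β z)

  Settled : ∀ {w} → AuctionState w → Set
  Settled {w} S = ∀ x → (∃ λ y → m y ≡ just x) ⊎ (∀ y → w x y ≤ β y)
    where open AuctionState S

  module _ {w : V → V → ℕ} (S : AuctionState w) where
    open AuctionState S

    price-≤ : ∀ {W} → (∀ x y → w x y ≤ W) → ∀ y → β y ≤ W
    price-≤ w≤W y with m y in eq
    ... | nothing = subst (_≤ _) (sym (unowned eq)) z≤n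
    ... | just x  = ≤-trans (proj₂ (owned eq)) (w≤W x y)

    -- The bidder takes a best object, so after paying one more it is still within one of its best
    -- surplus. The owners of the other objects stay content because the only price that changes
    -- goes up. A previous owner of `y` is displaced and becomes free to bid again.
    bid : ∀ {x y} → (∀ z → m z ≢ just x) → β y < w x y →
      (∀ z → w x z + β y ≤ w x y + β z) →
      Σ (AuctionState w) λ S′ → AuctionState.β S′ ≡ β [ y ↦ suc (β y) ]
    bid {x} {y} free β<w best = record
      { m = m′ ; β = β′ ; m-inj = inj′ ; owned = owned′ ; unowned = unowned′ ; content = content′ } , refl
      where
      m′ : V → Maybe V
      m′ = m [ y ↦ just x ]
      β′ : V → ℕ
      β′ = β [ y ↦ suc (β y) ]
      β≤β′ : ∀ z → β z ≤ β′ z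
      β≤β′ z with z ≟ᵛ y
      ... | yes refl = n≤1+n _
      ... | no _     = ≤-refl
      inj′ : Injective m′
      inj′ {u} {z} {z′} p q with z ≟ᵛ y | z′ ≟ᵛ y
      ... | yes refl | yes refl = refl
      ... | yes refl | no _     = contradiction (trans q (sym p)) (free z′)
      ... | no _     | yes refl = contradiction (trans p (sym q)) (free z)
      ... | no _     | no _     = m-inj p q
      owned′ : ∀ {u z} → m′ z ≡ just u → 0 < β′ z × β′ z ≤ w u z
      owned′ {u} {z} p with z ≟ᵛ y
      owned′ refl | yes refl = z<s , β<w
      ... | no _     = owned p
      unowned′ : ∀ {z} → m′ z ≡ nothing → β′ z ≡ 0
      unowned′ {z} p with z ≟ᵛ y
      ... | no _ = unowned p
      content′ : ∀ {u z} → m′ z ≡ just u → ∀ z′ → w u z′ + β′ z ≤ suc (w u z + β′ z′)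
      content′ {u} {z} p z′ with z ≟ᵛ y
      content′ {u} {z} refl z′ | yes refl = begin
        w u z′ + suc (β z)     ≡⟨ +-suc (w u z′) (β z) ⟩
        suc (w u z′ + β z)     ≤⟨ s≤s (best z′) ⟩
        suc (w u z + β z′)     ≤⟨ s≤s (+-monoʳ-≤ (w u z) (β≤β′ z′)) ⟩
        suc (w u z + β′ z′)    ∎
        where open ≤-Reasoning
      ... | no _ = ≤-trans (content p z′) (s≤s (+-monoʳ-≤ (w u z) (β≤β′ z′)))

    Unsettled : V → Set
    Unsettled x = (∀ z → m z ≢ just x) × 0 < maximum (λ y → w x y ∸ β y) pts

    settled? : Settled S ⊎ ∃ Unsettled
    settled? with Any.any? (λ x → ¬? (matched? m x) ×-dec (0 <? maximum (λ y → w x y ∸ β y) pts)) pts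
    ... | yes u with x , _ , free , pos ← find u = inj₂ (x , (λ z eq → free (lose (complete z) eq)) , pos)
    ... | no ¬u = inj₁ λ x → help x (matched? m x)
      where
      help : ∀ x → Dec (Any (λ y → m y ≡ just x) pts) → (∃ λ y → m y ≡ just x) ⊎ (∀ y → w x y ≤ β y)
      help x (yes p) with y , _ , eq ← find p = inj₁ (y , eq)
      help x (no ¬p) = inj₂ λ y → m∸n≡0⇒m≤n (n≤0⇒n≡0 (≤-trans (≤-maximum (λ y → w x y ∸ β y) (complete y))
        (≮⇒≥ λ pos → ¬u (lose (complete x) (¬p , pos)))))

    raise : ∃ Unsettled →
      Σ (AuctionState w) λ S′ → sum (map β pts) < sum (map (AuctionState.β S′) pts)
    raise (x , free , pos) = proj₁ next ,
      subst (λ β′ → sum (map β pts) < sum (map β′ pts)) (sym (proj₂ next)) (sum-map-strict β _ β≤ (complete y) β<)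
      where
      attained = maximum-attained (λ y → w x y ∸ β y) pts pos
      y  = proj₁ attained
      eq = proj₂ attained
      β<w : β y < w x y
      β<w = m∸n≢0⇒n<m λ z → n≮0 (subst (0 <_) (trans (sym eq) z) pos)
      -- Since the maximum is positive, the surplus of `y` is not truncated, and comparing truncated
      -- surpluses yields an additive inequality.
      best : ∀ z → w x z + β y ≤ w x y + β z
      best z = begin
        w x z + β y                  ≤⟨ +-monoˡ-≤ (β y) (m≤n+m∸n (w x z) (β z)) ⟩
        β z + (w x z ∸ β z) + β y    ≤⟨ +-monoˡ-≤ (β y) (+-monoʳ-≤ (β z) (≤-trans (≤-maximum (λ y → w x y ∸ β y) (complete z)) (≤-reflexive (sym eq)))) ⟩
        β z + (w x y ∸ β y) + β y    ≡⟨ +-assoc (β z) _ _ ⟩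
        β z + (w x y ∸ β y + β y)    ≡⟨ cong (β z +_) (m∸n+n≡m (<⇒≤ β<w)) ⟩
        β z + w x y                  ≡⟨ +-comm (β z) _ ⟩
        w x y + β z                  ∎
        where open ≤-Reasoning
      next = bid free β<w best
      β≤ : ∀ z → β z ≤ (β [ y ↦ suc (β y) ]) z
      β≤ z with z ≟ᵛ y
      ... | yes refl = n≤1+n _
      ... | no _     = ≤-refl
      β< : β y < (β [ y ↦ suc (β y) ]) y
      β< = ≤-reflexive (sym (update-same β y (suc (β y))))

  -- Every bid increases the sum of the prices. That sum is bounded: an owned object costs at most
  -- its weight for the owner, an unowned one costs nothing. The fuel dominates the room left below
  -- the bound, so a raise with no fuel left would break the bound.
  auction : (w : V → V → ℕ) → ∃ λ (S : AuctionState w) → Settled S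
  auction w = run _ initial (m≤m+n _ _)
    where
    initial : AuctionState w
    initial = record { m = λ _ → nothing ; β = λ _ → 0 ; m-inj = λ () ; owned = λ () ; unowned = λ _ → refl ; content = λ () }
    W : ℕ
    W = maximum (λ x → maximum (w x) pts) pts
    w≤W : ∀ x y → w x y ≤ W
    w≤W x y = ≤-trans (≤-maximum (w x) (complete y)) (≤-maximum (λ x → maximum (w x) pts) (complete x))
    bound : ℕ
    bound = sum (map (λ _ → W) pts)
    run : ∀ fuel (S : AuctionState w) → bound ≤ fuel + sum (map (AuctionState.β S) pts) →
      ∃ λ (S : AuctionState w) → Settled S
    run fuel S le with settled? S
    ... | inj₁ settled = S , settled
    ... | inj₂ x with S′ , lt ← raise S x with fuel
    ...   | zero  = contradiction (sum-map-mono _ _ (price-≤ S′ w≤W) pts) (<⇒≱ (≤-<-trans le lt))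
    ...   | suc k = run k S′ (≤-trans le (≤-trans (≤-reflexive (sym (+-suc k _))) (+-monoʳ-≤ k lt)))

  -- Linear programming duality in certificate form, with `m` sending a right vertex to its left
  -- mate. `covers` is dual feasibility; `tight`, `α-matched` and `β-matched` are complementary
  -- slackness, which makes `m` and (α, β) optimal.
  record DualPair (w : V → V → ℕ) : Set where
    field
      m         : V → Maybe V
      α β       : V → ℕ
      m-inj     : Injective m
      covers    : ∀ x y → w x y ≤ α x + β y
      tight     : ∀ {x y} → m y ≡ just x → α x + β y ≡ w x y
      positive  : ∀ {x y} → m y ≡ just x → 0 < w x y
      α-matched : ∀ {x} → 0 < α x → ∃ λ y → m y ≡ just x
      β-matched : ∀ {y} → 0 < β y → ∃ λ x → m y ≡ just x

  -- Running the auction on the weights K w with K > |V| leaves a residue class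
  -- modulo K that no price meets; rounding there makes the dual pair exact.
  private
    K : ℕ
    K = suc (length pts)

    -- The floor of a quotient by `K` jumps only at multiples of `K`. Away from them the slack of
    -- one in `content` vanishes under rounding.
    suc-/ : ∀ b → ¬ (K ∣ suc b) → suc b / K ≤ b / K
    suc-/ b K∤ = subst (_≤ b / K) (m*n/n≡m (suc b / K) K) (/-monoˡ-≤ K (≤-pred
      (≤∧≢⇒< (m/n*n≤m (suc b) K) λ eq → K∤ (divides (suc b / K) (sym eq)))))

    -- Pigeonhole: a point spoils at most one θ below `K`, since two spoiled values would differ by
    -- a positive multiple of `K` that is smaller than `K`. There are `K` candidates and only `K` -
    -- 1 points in the list.
    offset : (β : V → ℕ) → ∃ λ θ → θ < K × (∀ y → ¬ (K ∣ suc (β y + θ)))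
    offset β with Any.any? (λ θ → All.all? (λ y → ¬? (K ∣? suc (β y + θ))) pts) (upTo K)
    ... | yes p with θ , θ∈ , all ← find p = θ , ∈-upTo⁻ θ∈ , λ y → All.lookup all (complete y)
    ... | no ¬p = contradiction
      (≤-trans (≤-reflexive (sym (length-upTo K))) (length-≤-of-injective (λ θ y → K ∣ suc (β y + θ)) (Uniq.upTo⁺ K) total inj))
      (<⇒≱ ≤-refl)
      where
      total : ∀ {θ} → θ ∈ upTo K → ∃ λ y → y ∈ pts × K ∣ suc (β y + θ)
      total {θ} θ∈ with y , y∈ , nn ← find (¬All⇒Any¬ (λ y → ¬? (K ∣? suc (β y + θ))) pts (λ all → ¬p (lose θ∈ all))) =
        y , y∈ , decidable-stable (K ∣? _) nn
      le : ∀ {θ θ′ b} → θ′ < K → K ∣ suc (b + θ) → K ∣ suc (b + θ′) → θ′ ≤ θ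
      le {θ} {θ′} {b} θ′<K p q = ≮⇒≥ λ θ<θ′ → <⇒≱ (≤-<-trans (m∸n≤m θ′ θ) θ′<K)
        (∣⇒≤ {{>-nonZero (m<n⇒0<n∸m θ<θ′)}} (∣m+n∣m⇒∣n (subst (K ∣_) (cong suc (trans (cong (b +_) (sym (m+[n∸m]≡n (<⇒≤ θ<θ′)))) (sym (+-assoc b θ (θ′ ∸ θ))))) q) p))
      inj : ∀ {θ θ′ y} → θ ∈ upTo K → θ′ ∈ upTo K → K ∣ suc (β y + θ) → K ∣ suc (β y + θ′) → θ ≡ θ′
      inj {y = y} θ∈ θ′∈ p q = ≤-antisym (le {b = β y} (∈-upTo⁻ θ∈) q p) (le {b = β y} (∈-upTo⁻ θ′∈) p q)

  egerváry : (w : V → V → ℕ) → DualPair w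
  egerváry w with S , settled ← auction (λ x y → w x y * K)
    with θ , θ<K , good ← offset (AuctionState.β S) = record
    { m = m ; α = α ; β = β₀ ; m-inj = m-inj
    ; covers = λ x y → ≤-trans (m≤n+m∸n (w x y) (β₀ y)) (≤-trans (≤-reflexive (+-comm (β₀ y) _))
        (+-monoˡ-≤ (β₀ y) (≤-maximum (λ y → w x y ∸ β₀ y) (complete y))))
    ; tight = tight ; positive = positive ; α-matched = α-matched ; β-matched = β-matched }
    where
    open AuctionState S
    β₀ : V → ℕ
    β₀ y = (β y + θ) / K
    -- The best surplus at the prices `β₀`, truncated at zero: the least choice that is feasible
    -- against `β₀`.
    α : V → ℕ
    α x = maximum (λ y → w x y ∸ β₀ y) pts
    absorb : ∀ u b → (u * K + b) / K ≡ u + b / K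
    absorb u b = trans (+-distrib-/-∣ˡ b (n∣m*n u)) (cong (_+ b / K) (m*n/n≡m u K))
    -- Add θ and divide by `K`: the multiples of `K` come out whole, and the extra one on the right
    -- is lost because `good` keeps `suc (β z + θ)` off the multiples of `K`.
    content₀ : ∀ {x y} → m y ≡ just x → ∀ z → w x z + β₀ y ≤ w x y + β₀ z
    content₀ {x} {y} eq z = begin
      w x z + β₀ y                          ≡⟨ absorb (w x z) _ ⟨
      (w x z * K + (β y + θ)) / K           ≤⟨ /-monoˡ-≤ K le ⟩
      (w x y * K + suc (β z + θ)) / K       ≡⟨ absorb (w x y) _ ⟩
      w x y + suc (β z + θ) / K             ≤⟨ +-monoʳ-≤ (w x y) (suc-/ _ (good z)) ⟩
      w x y + β₀ z                          ∎
      where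
      open ≤-Reasoning
      le : w x z * K + (β y + θ) ≤ w x y * K + suc (β z + θ)
      le = begin
        w x z * K + (β y + θ)         ≡⟨ +-assoc (w x z * K) _ _ ⟨
        w x z * K + β y + θ           ≤⟨ +-monoˡ-≤ θ (content eq z) ⟩
        suc (w x y * K + β z) + θ     ≡⟨ cong suc (+-assoc (w x y * K) _ _) ⟩
        suc (w x y * K + (β z + θ))   ≡⟨ +-suc (w x y * K) _ ⟨
        w x y * K + suc (β z + θ)     ∎
    -- As θ lies below `K`, it disappears in the division: a rounded price stays at most the owner's
    -- weight, and in `β-matched` an unowned object keeps price zero.
    β₀≤w : ∀ {x y} → m y ≡ just x → β₀ y ≤ w x y
    β₀≤w {x} {y} eq = begin
      (β y + θ) / K          ≤⟨ /-monoˡ-≤ K (+-monoˡ-≤ θ (proj₂ (owned eq))) ⟩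
      (w x y * K + θ) / K    ≡⟨ absorb (w x y) θ ⟩
      w x y + θ / K          ≡⟨ cong (w x y +_) (m<n⇒m/n≡0 θ<K) ⟩
      w x y + 0              ≡⟨ +-identityʳ _ ⟩
      w x y                  ∎
      where open ≤-Reasoning
    tight : ∀ {x y} → m y ≡ just x → α x + β₀ y ≡ w x y
    tight {x} {y} eq = trans (cong (_+ β₀ y) (≤-antisym
      (maximum-≤ _ best pts)
      (≤-maximum (λ y → w x y ∸ β₀ y) (complete y)))) (m∸n+n≡m (β₀≤w eq))
      where
      best : ∀ z → w x z ∸ β₀ z ≤ w x y ∸ β₀ y
      best z = m≤n+o⇒m∸n≤o (w x z) (β₀ z) (≤-trans (m+n≤o⇒m≤o∸n (w x z) (content₀ eq z))
        (≤-reflexive (trans (cong (_∸ β₀ y) (+-comm (w x y) (β₀ z))) (+-∸-assoc (β₀ z) (β₀≤w eq)))))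
    positive : ∀ {x y} → m y ≡ just x → 0 < w x y
    positive {x} {y} eq with w x y | ≤-trans (proj₁ (owned eq)) (proj₂ (owned eq))
    ... | suc _ | _ = z<s
    α-matched : ∀ {x} → 0 < α x → ∃ λ y → m y ≡ just x
    α-matched {x} pos with settled x
    ... | inj₁ p = p
    ... | inj₂ le = contradiction (maximum-≤ _ (λ y → ≤-reflexive (m≤n⇒m∸n≡0 (w≤β₀ y))) pts) (<⇒≱ pos)
      where
      w≤β₀ : ∀ y → w x y ≤ β₀ y
      w≤β₀ y = subst (_≤ β₀ y) (m*n/n≡m (w x y) K) (/-monoˡ-≤ K (≤-trans (le y) (m≤m+n _ θ)))
    β-matched : ∀ {y} → 0 < β₀ y → ∃ λ x → m y ≡ just x
    β-matched {y} pos with m y in eq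
    ... | just x  = x , refl
    ... | nothing = contradiction (trans (cong (λ b → (b + θ) / K) (unowned eq)) (m<n⇒m/n≡0 θ<K)) (λ e → n≮0 (subst (0 <_) e pos))

-- Binary digits and distances in the augmented hypergrid

lsb : ℕ → ℕ
lsb 0             = 0
lsb 1             = 1
lsb (suc (suc n)) = lsb n

bit : ℕ → ℕ → ℕ
bit zero    D = lsb D
bit (suc a) D = bit a ⌊ D /2⌋

-- The first argument is the number of low digits read and drives the recursion. Taking it to be `n`
-- reads every digit of a coordinate difference, since such a difference is below `2 ^ n`.
popcount : ℕ → ℕ → ℕ
popcount zero    D = 0
popcount (suc k) D = lsb D + popcount k ⌊ D /2⌋

+2*suc : ∀ m D → D + 2 * suc m ≡ suc (suc (D + 2 * m))
+2*suc m D = trans (cong (D +_) (*-suc 2 m)) (trans (+-suc D _) (cong suc (+-suc D _)))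

lsb-+2* : ∀ m D → lsb (D + 2 * m) ≡ lsb D
lsb-+2* zero    D = cong lsb (+-identityʳ D)
lsb-+2* (suc m) D = trans (cong lsb (+2*suc m D)) (lsb-+2* m D)

half-+2* : ∀ m D → ⌊ D + 2 * m /2⌋ ≡ ⌊ D /2⌋ + m
half-+2* zero    D = trans (cong ⌊_/2⌋ (+-identityʳ D)) (sym (+-identityʳ _))
half-+2* (suc m) D = trans (cong ⌊_/2⌋ (+2*suc m D)) (trans (cong suc (half-+2* m D)) (sym (+-suc _ m)))

lsb+2*half : ∀ D → lsb D + 2 * ⌊ D /2⌋ ≡ D
lsb+2*half 0             = refl
lsb+2*half 1             = refl
lsb+2*half (suc (suc D)) = trans (cong (lsb D +_) (*-suc 2 ⌊ D /2⌋))
  (trans (+-suc (lsb D) _) (cong suc (trans (+-suc (lsb D) _) (cong suc (lsb+2*half D)))))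

popcount-step : ∀ k m D → popcount (suc k) (D + 2 * m) ≡ lsb D + popcount k (⌊ D /2⌋ + m)
popcount-step k m D = cong₂ _+_ (lsb-+2* m D) (cong (popcount k) (half-+2* m D))

half-suc : ∀ D → (lsb D ≡ 0 × lsb (suc D) ≡ 1 × ⌊ suc D /2⌋ ≡ ⌊ D /2⌋) ⊎
                 (lsb D ≡ 1 × lsb (suc D) ≡ 0 × ⌊ suc D /2⌋ ≡ suc ⌊ D /2⌋)
half-suc 0             = inj₁ (refl , refl , refl)
half-suc 1             = inj₂ (refl , refl , refl)
half-suc (suc (suc D)) with half-suc D
... | inj₁ (p , q , r) = inj₁ (p , q , cong suc r)
... | inj₂ (p , q , r) = inj₂ (p , q , cong suc r)

popcount-suc : ∀ k D → popcount k (suc D) ≤ suc (popcount k D)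
popcount-suc zero    D = z≤n
popcount-suc (suc k) D with half-suc D
... | inj₁ (p , q , r) rewrite p | q | r = ≤-refl
... | inj₂ (p , q , r) rewrite p | q | r = ≤-trans (popcount-suc k ⌊ D /2⌋) (n≤1+n _)

-- A carry clears a run of ones and then sets a single digit, so at most one new one appears.
popcount-+2^ : ∀ k a D → popcount k (D + 2 ^ a) ≤ suc (popcount k D)
popcount-+2^ zero    a       D = z≤n
popcount-+2^ (suc k) zero    D rewrite +-comm D 1 = popcount-suc (suc k) D
popcount-+2^ (suc k) (suc a) D rewrite popcount-step k (2 ^ a) D =
  ≤-trans (+-monoʳ-≤ (lsb D) (popcount-+2^ k a ⌊ D /2⌋)) (≤-reflexive (+-suc (lsb D) _))

-- The addition clears digit `a`, which pays for the single digit that the carry may set higher up.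
popcount-carry : ∀ k a D → bit a D ≡ 1 → popcount k (D + 2 ^ a) ≤ popcount k D
popcount-carry zero    a       D eq = z≤n
popcount-carry (suc k) (suc a) D eq rewrite popcount-step k (2 ^ a) D =
  +-monoʳ-≤ (lsb D) (popcount-carry k a ⌊ D /2⌋ eq)
popcount-carry (suc k) zero    D eq rewrite +-comm D 1 with half-suc D
... | inj₁ (p , q , r) = contradiction (trans (sym p) eq) λ ()
... | inj₂ (p , q , r) rewrite p | q | r = popcount-suc k ⌊ D /2⌋

-- `E` is `D` minus `2 ^ a`, given additively to avoid truncated subtraction. The bound `a < k`
-- keeps the cleared digit among those that `popcount k` reads.
clear-bit : ∀ a D → bit a D ≡ 1 → ∃ λ E → D ≡ E + 2 ^ a × (∀ k → a < k → popcount k D ≡ suc (popcount k E))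
clear-bit zero    D eq = 2 * ⌊ D /2⌋ , D≡ , λ { (suc k) _ → help k }
  where
  D≡ : D ≡ 2 * ⌊ D /2⌋ + 1
  D≡ = trans (sym (lsb+2*half D)) (trans (cong (_+ 2 * ⌊ D /2⌋) eq) (+-comm 1 _))
  help : ∀ k → popcount (suc k) D ≡ suc (popcount (suc k) (2 * ⌊ D /2⌋))
  help k rewrite popcount-step k ⌊ D /2⌋ 0 | eq = refl
clear-bit (suc a) D eq with E , D/2≡ , pop ← clear-bit a ⌊ D /2⌋ eq =
  lsb D + 2 * E , D≡ , λ { (suc k) (s≤s a<k) → help k a<k }
  where
  D≡ : D ≡ lsb D + 2 * E + 2 ^ suc a
  D≡ = begin
    D                                   ≡⟨ lsb+2*half D ⟨
    lsb D + 2 * ⌊ D /2⌋              ≡⟨ cong (λ h → lsb D + 2 * h) D/2≡ ⟩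
    lsb D + 2 * (E + 2 ^ a)          ≡⟨ cong (lsb D +_) (*-distribˡ-+ 2 E (2 ^ a)) ⟩
    lsb D + (2 * E + 2 * 2 ^ a)      ≡⟨ +-assoc (lsb D) _ _ ⟨
    lsb D + 2 * E + 2 ^ suc a        ∎
    where open ≡-Reasoning
  lsb² : ∀ D → lsb (lsb D) ≡ lsb D × ⌊ lsb D /2⌋ ≡ 0
  lsb² 0 = refl , refl
  lsb² 1 = refl , refl
  lsb² (suc (suc D)) = lsb² D
  help : ∀ k → a < k → popcount (suc k) D ≡ suc (popcount (suc k) (lsb D + 2 * E))
  help k a<k rewrite popcount-step k E (lsb D) | proj₁ (lsb² D) | proj₂ (lsb² D) | pop k a<k =
    +-suc (lsb D) _

exists-bit : ∀ k D → 0 < D → D < 2 ^ k → ∃ λ a → a < k × bit a D ≡ 1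
exists-bit zero    D pos lt = contradiction pos (<⇒≱ lt)
exists-bit (suc k) D pos lt with half-suc D
... | inj₂ (odd , _) = 0 , z<s , odd
... | inj₁ (even , _) = let a , a<k , eq = exists-bit k ⌊ D /2⌋ half>0 half< in suc a , s≤s a<k , eq
  where
  D≡ : 2 * ⌊ D /2⌋ ≡ D
  D≡ = trans (cong (_+ 2 * ⌊ D /2⌋) (sym even)) (lsb+2*half D)
  half>0 : 0 < ⌊ D /2⌋
  half>0 = n≢0⇒n>0 λ z → <⇒≢ pos (trans (cong (2 *_) (sym z)) D≡)
  half< : ⌊ D /2⌋ < 2 ^ k
  half< = *-cancelˡ-< 2 _ _ (subst (_< 2 ^ suc k) (sym D≡) lt)

lsb-≤1 : ∀ D → lsb D ≤ 1
lsb-≤1 0             = z≤n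
lsb-≤1 1             = ≤-refl
lsb-≤1 (suc (suc D)) = lsb-≤1 D

popcount-≤ : ∀ k D → popcount k D ≤ k
popcount-≤ zero    D = z≤n
popcount-≤ (suc k) D = +-mono-≤ (lsb-≤1 D) (popcount-≤ k ⌊ D /2⌋)

popcount-0 : ∀ k → popcount k 0 ≡ 0
popcount-0 zero    = refl
popcount-0 (suc k) = popcount-0 k

sumFin : ∀ {d} → (Fin d → ℕ) → ℕ
sumFin g = sum (tabulate g)

sumFin-cong : ∀ {d} {g h : Fin d → ℕ} → (∀ j → g j ≡ h j) → sumFin g ≡ sumFin h
sumFin-cong {zero}  eq = refl
sumFin-cong {suc d} eq = cong₂ _+_ (eq fzero) (sumFin-cong (eq ∘ fsuc))

-- Both sides carry the other function's i-th term so that no subtraction occurs.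
sumFin-at : ∀ {d} (i : Fin d) {g h : Fin d → ℕ} → (∀ j → j ≢ i → g j ≡ h j) →
  sumFin g + h i ≡ sumFin h + g i
sumFin-at fzero {g} {h} eq
  rewrite sumFin-cong {g = g ∘ fsuc} {h ∘ fsuc} (λ j → eq (fsuc j) λ ()) = xy∙z≈zy∙x (g fzero) _ (h fzero)
sumFin-at (fsuc i) {g} {h} eq =
  trans (+-assoc (g fzero) _ _) (trans (cong₂ _+_ (eq fzero λ ()) (sumFin-at i (λ j j≢i → eq (fsuc j) (j≢i ∘ Fin.suc-injective)))) (sym (+-assoc (h fzero) _ _)))

sumFin-≤ : ∀ {d} b {g : Fin d → ℕ} → (∀ j → g j ≤ b) → sumFin g ≤ d * b
sumFin-≤ {zero}  b le = z≤n
sumFin-≤ {suc d} b le = +-mono-≤ (le fzero) (sumFin-≤ b (le ∘ fsuc))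

n<2^n : ∀ n → n < 2 ^ n
n<2^n zero    = z<s
n<2^n (suc n) = ≤-trans (+-mono-≤ (m^n>0 2 n) (n<2^n n)) (≤-reflexive (cong (2 ^ n +_) (sym (+-identityʳ _))))

module _ {n d : ℕ} where

  -- An edge of the augmented hypergrid whose direction and exponent are fixed in the type, so that
  -- a matched pair can be translated by one and the same vector at both ends.
  record Shift (i : Fin d) (a : ℕ) (x y : Point n d) : Set where
    constructor shift
    field
      at  : toℕ (lookup y i) ≡ toℕ (lookup x i) + 2 ^ a
      off : ∀ j → j ≢ i → lookup x j ≡ lookup y j

  lookup-ext : ∀ {m} {x y : Vec (Fin n) m} → (∀ j → lookup x j ≡ lookup y j) → x ≡ y
  lookup-ext {x = []}     {[]}     eq = refl
  lookup-ext {x = x ∷ xs} {y ∷ ys} eq = cong₂ _∷_ (eq fzero) (lookup-ext (eq ∘ fsuc))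

  ext-at : ∀ i {x y : Point n d} → toℕ (lookup x i) ≡ toℕ (lookup y i) → (∀ j → j ≢ i → lookup x j ≡ lookup y j) → x ≡ y
  ext-at i {x} {y} at off = lookup-ext λ j → help j (j Fin.≟ i)
    where
    help : ∀ j → Dec (j ≡ i) → lookup x j ≡ lookup y j
    help j (yes refl) = Fin.toℕ-injective at
    help j (no j≢i)   = off j j≢i

  shift-functional : ∀ {i a x y z} → Shift i a x y → Shift i a x z → y ≡ z
  shift-functional {i} (shift p q) (shift p′ q′) = ext-at i (trans p (sym p′)) λ j j≢i → trans (sym (q j j≢i)) (q′ j j≢i)

  shift-injective : ∀ {i a x y z} → Shift i a x z → Shift i a y z → x ≡ y
  shift-injective {i} {a} (shift p q) (shift p′ q′) =
    ext-at i (+-cancelʳ-≡ (2 ^ a) _ _ (trans (sym p) p′)) λ j j≢i → trans (q j j≢i) (sym (q′ j j≢i))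

  shift-up : ∀ i a x → toℕ (lookup x i) + 2 ^ a < n → ∃ λ y → Shift i a x y
  shift-up i a x lt = x [ i ]≔ fromℕ< lt , shift (trans (cong toℕ (Vec.lookup∘update i x _)) (Fin.toℕ-fromℕ< lt))
    λ j j≢i → sym (Vec.lookup∘update′ j≢i x _)

  shift-down : ∀ i a y → 2 ^ a ≤ toℕ (lookup y i) → ∃ λ x → Shift i a x y
  shift-down i a y le = y [ i ]≔ fromℕ< lt ,
    shift (trans (sym (m∸n+n≡m le)) (cong (_+ 2 ^ a) (sym (trans (cong toℕ (Vec.lookup∘update i y _)) (Fin.toℕ-fromℕ< lt)))))
    λ j j≢i → Vec.lookup∘update′ j≢i y _
    where
    lt : toℕ (lookup y i) ∸ 2 ^ a < n
    lt = ≤-<-trans (m∸n≤m _ (2 ^ a)) (Fin.toℕ<n (lookup y i))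

  shift-⪯ : ∀ {i a x y} → Shift i a x y → x ⪯ y
  shift-⪯ {i} {a} {x} {y} (shift p q) j with j Fin.≟ i
  ... | yes refl = ≤-trans (m≤m+n _ (2 ^ a)) (≤-reflexive (sym p))
  ... | no j≢i   = ≤-reflexive (cong toℕ (q j j≢i))

  -- Truncated subtraction: meaningful for x ⪯ y.
  gap : Point n d → Point n d → Fin d → ℕ
  gap x y j = toℕ (lookup y j) ∸ toℕ (lookup x j)

  dist : Point n d → Point n d → ℕ
  dist x y = sumFin λ j → popcount n (gap x y j)

  gap-<2^n : ∀ x y j → gap x y j < 2 ^ n
  gap-<2^n x y j = <-trans (≤-<-trans (m∸n≤m _ (toℕ (lookup x j))) (Fin.toℕ<n (lookup y j))) (n<2^n n)

  dist-≤ : ∀ x y → dist x y ≤ d * n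
  dist-≤ x y = sumFin-≤ n λ j → popcount-≤ n (gap x y j)

  private
    change : ∀ i {x y x′ y′} → (∀ j → j ≢ i → gap x y j ≡ gap x′ y′ j) →
      dist x y + popcount n (gap x′ y′ i) ≡ dist x′ y′ + popcount n (gap x y i)
    change i off = sumFin-at i λ j j≢i → cong (popcount n) (off j j≢i)

    off-source : ∀ {i a x x′} y → Shift i a x x′ → ∀ j → j ≢ i → gap x y j ≡ gap x′ y j
    off-source y (shift _ q) j j≢i = cong (λ z → toℕ (lookup y j) ∸ toℕ z) (q j j≢i)

    off-target : ∀ {i a y y′} x → Shift i a y y′ → ∀ j → j ≢ i → gap x y j ≡ gap x y′ j
    off-target x (shift _ q) j j≢i = cong (λ z → toℕ z ∸ toℕ (lookup x j)) (q j j≢i)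

  gap-source : ∀ {i a x x′} y → Shift i a x x′ → x′ ⪯ y → gap x y i ≡ gap x′ y i + 2 ^ a
  gap-source {i} {a} {x} {x′} y (shift p _) le = sym (trans (sym (+-∸-comm _ (le i)))
    (trans (cong₂ _∸_ (+-comm (toℕ (lookup y i)) (2 ^ a)) (trans p (+-comm _ (2 ^ a)))) ([m+n]∸[m+o]≡n∸o (2 ^ a) _ _)))

  gap-target : ∀ {i a y y′} x → Shift i a y y′ → x ⪯ y → gap x y′ i ≡ gap x y i + 2 ^ a
  gap-target {i} {a} {y} {y′} x (shift p _) le = trans (cong (_∸ toℕ (lookup x i)) p) (+-∸-comm _ (le i))

  -- Translating both ends leaves all coordinate differences alone; hence a violated pair and a
  -- violated translate of it have equal weight.
  dist-shift : ∀ {i a x x′ y y′} → Shift i a x x′ → Shift i a y y′ → dist x y ≡ dist x′ y′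
  dist-shift {i} {a} {x} {x′} {y} {y′} (shift p q) (shift p′ q′) = sumFin-cong λ j → cong (popcount n) (help j (j Fin.≟ i))
    where
    help : ∀ j → Dec (j ≡ i) → gap x y j ≡ gap x′ y′ j
    help j (yes refl) = trans (sym ([m+n]∸[m+o]≡n∸o (2 ^ a) _ _))
      (cong₂ _∸_ (trans (+-comm (2 ^ a) _) (sym p′)) (trans (+-comm (2 ^ a) _) (sym p)))
    help j (no j≢i)   = cong₂ _∸_ (cong toℕ (q′ j j≢i)) (cong toℕ (q j j≢i))

  -- This gives the lower bound on walk lengths: an edge removes one power of two from one
  -- difference, and restoring it adds at most one to the popcount.
  dist-step : ∀ {i a x x′} y → Shift i a x x′ → x′ ⪯ y → dist x y ≤ suc (dist x′ y)
  dist-step {i} {a} {x} {x′} y s le = +-cancelʳ-≤ _ _ _ (begin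
    dist x y + popcount n (gap x′ y i)         ≡⟨ change i {x} {y} {x′} {y} (off-source y s) ⟩
    dist x′ y + popcount n (gap x y i)         ≡⟨ cong (λ g → dist x′ y + popcount n g) (gap-source y s le) ⟩
    dist x′ y + popcount n (gap x′ y i + 2 ^ a) ≤⟨ +-monoʳ-≤ (dist x′ y) (popcount-+2^ n a _) ⟩
    dist x′ y + suc (popcount n (gap x′ y i))   ≡⟨ +-suc (dist x′ y) _ ⟩
    suc (dist x′ y) + popcount n (gap x′ y i)   ∎)
    where open ≤-Reasoning

  dist-carry : ∀ {i a y y′} x → Shift i a y y′ → x ⪯ y → bit a (gap x y i) ≡ 1 → dist x y′ ≤ dist x y
  dist-carry {i} {a} {y} {y′} x s le b = +-cancelʳ-≤ _ _ _ (begin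
    dist x y′ + popcount n (gap x y i)         ≡⟨ change i {x} {y} {x} {y′} (off-target x s) ⟨
    dist x y + popcount n (gap x y′ i)         ≡⟨ cong (λ g → dist x y + popcount n g) (gap-target x s le) ⟩
    dist x y + popcount n (gap x y i + 2 ^ a)  ≤⟨ +-monoʳ-≤ (dist x y) (popcount-carry n a _ b) ⟩
    dist x y + popcount n (gap x y i)          ∎)
    where open ≤-Reasoning

  -- Moving `x` up by `2 ^ a` clears exactly the set digit `a` of one difference and leaves all
  -- other digits alone.
  advance : ∀ {i a} x y → x ⪯ y → a < n → bit a (gap x y i) ≡ 1 →
    ∃ λ x′ → Shift i a x x′ × x′ ⪯ y × dist x y ≡ suc (dist x′ y)
  advance {i} {a} x y le a<n b with E , gap≡ , pop ← clear-bit a (gap x y i) b =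
    x′ , s , x′⪯y , +-cancelʳ-≡ (popcount n E) _ _ (begin
      dist x y + popcount n E                  ≡⟨ cong (λ g → dist x y + popcount n g) gap′≡ ⟨
      dist x y + popcount n (gap x′ y i)       ≡⟨ change i {x} {y} {x′} {y} (off-source y s) ⟩
      dist x′ y + popcount n (gap x y i)       ≡⟨ cong (dist x′ y +_) (pop n a<n) ⟩
      dist x′ y + suc (popcount n E)           ≡⟨ +-suc (dist x′ y) _ ⟩
      suc (dist x′ y) + popcount n E           ∎)
    where
    open ≡-Reasoning
    xᵢ = toℕ (lookup x i)
    yᵢ = toℕ (lookup y i)
    xᵢ+2^a≤yᵢ : xᵢ + 2 ^ a ≤ yᵢ
    xᵢ+2^a≤yᵢ = ≤-trans (+-monoʳ-≤ xᵢ (≤-trans (m≤n+m (2 ^ a) E) (≤-reflexive (sym gap≡)))) (≤-reflexive (m+[n∸m]≡n (le i)))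
    -- The shifted coordinate does not pass that of `y`, so it stays inside the grid.
    up = shift-up i a x (≤-<-trans xᵢ+2^a≤yᵢ (Fin.toℕ<n (lookup y i)))
    x′ = proj₁ up
    s : Shift i a x x′
    s = proj₂ up
    x′⪯y : x′ ⪯ y
    x′⪯y j with j Fin.≟ i
    ... | yes refl = ≤-trans (≤-reflexive (Shift.at s)) xᵢ+2^a≤yᵢ
    ... | no j≢i   = ≤-trans (≤-reflexive (cong toℕ (sym (Shift.off s j j≢i)))) (le j)
    gap′≡ : gap x′ y i ≡ E
    gap′≡ = +-cancelʳ-≡ (2 ^ a) _ _ (trans (sym (gap-source y s x′⪯y)) gap≡)

  walk-⪯ : ∀ {k x y} → Walk {n} {d} k x y → x ⪯ y
  walk-⪯ here j = ≤-refl
  walk-⪯ (step {x = x} {x′} (i , a , at , off) walk) j =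
    ≤-trans (shift-⪯ {i} {a} {x} {x′} (shift at off) j) (walk-⪯ walk j)

  dist-self : ∀ x → dist x x ≡ 0
  dist-self x = n≤0⇒n≡0 (subst (dist x x ≤_) (*-zeroʳ d)
    (sumFin-≤ 0 λ j → ≤-reflexive (trans (cong (popcount n) (n∸n≡0 (toℕ (lookup x j)))) (popcount-0 n))))

  dist-≤-walk : ∀ {k x y} → Walk k x y → dist x y ≤ k
  dist-≤-walk {x = x} here             = ≤-reflexive (dist-self x)
  dist-≤-walk {y = y} (step {x = x} {x′} (i , a , at , off) walk) =
    ≤-trans (dist-step {i} {a} {x} {x′} y (shift at off) (walk-⪯ walk)) (s≤s (dist-≤-walk walk))

  -- Greedy: while the points differ, some difference has a set digit, and `advance` spends it on
  -- one edge. With `dist-≤-walk` this identifies `dist` as the directed distance.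
  shortest-walk : ∀ k x y → x ⪯ y → dist x y ≡ k → Walk k x y
  shortest-walk k x y le eq with Fin.all? (λ j → lookup x j Fin.≟ lookup y j)
  ... | yes x≡y with refl ← lookup-ext {x = x} {y} x≡y = subst (λ k → Walk k x x) (trans (sym (dist-self x)) eq) here
  ... | no ¬p with j , x≢y ← Fin.¬∀⟶∃¬ d _ (λ j → lookup x j Fin.≟ lookup y j) ¬p
    with a , a<n , b ← exists-bit n (gap x y j) (m<n⇒0<n∸m (≤∧≢⇒< (le j) (x≢y ∘ Fin.toℕ-injective))) (gap-<2^n x y j)
    with x′ , s , x′⪯y , dist≡ ← advance {j} {a} x y le a<n b with k
  ... | zero  = contradiction (trans (sym dist≡) eq) λ ()
  ... | suc k = step (j , a , Shift.at s , Shift.off s) (shortest-walk k x′ y x′⪯y (cong pred (trans (sym dist≡) eq)))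

  dist-isDistA : ∀ x y → x ⪯ y → IsDistA x y (dist x y)
  dist-isDistA x y le = shortest-walk _ x y le refl , λ _ → dist-≤-walk

-- Routing the matching through violated edges

length-filter-map : {P : B → Set} (P? : Decidable P) (g : A → B) → ∀ xs →
  length (filter P? (map g xs)) ≡ length (filter (P? ∘ g) xs)
length-filter-map P? g []       = refl
length-filter-map P? g (x ∷ xs) with does (P? (g x))
... | true  = cong suc (length-filter-map P? g xs)
... | false = length-filter-map P? g xs

length-filter-product : {P : A × B → Set} (P? : Decidable P) → ∀ xs ys →
  length (filter P? (cartesianProduct xs ys)) ≡ sum (map (λ x → length (filter (λ y → P? (x , y)) ys)) xs)
length-filter-product P? []       ys = refl
length-filter-product P? (x ∷ xs) ys = begin
  length (filter P? (map (x ,_) ys ++ cartesianProduct xs ys))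
    ≡⟨ cong length (filter-++ P? (map (x ,_) ys) _) ⟩
  length (filter P? (map (x ,_) ys) ++ filter P? (cartesianProduct xs ys))
    ≡⟨ length-++ (filter P? (map (x ,_) ys)) ⟩
  length (filter P? (map (x ,_) ys)) + length (filter P? (cartesianProduct xs ys))
    ≡⟨ cong₂ _+_ (length-filter-map P? (x ,_) ys) (length-filter-product P? xs ys) ⟩
  length (filter (λ y → P? (x , y)) ys) + sum (map (λ x → length (filter (λ y → P? (x , y)) ys)) xs) ∎
  where open ≡-Reasoning

sum-product : (g : A × B → ℕ) → ∀ xs ys →
  sum (map g (cartesianProduct xs ys)) ≡ sum (map (λ x → sum (map (λ y → g (x , y)) ys)) xs)
sum-product g []       ys = refl
sum-product g (x ∷ xs) ys = begin
  sum (map g (map (x ,_) ys ++ cartesianProduct xs ys))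
    ≡⟨ cong sum (map-++ g (map (x ,_) ys) _) ⟩
  sum (map g (map (x ,_) ys) ++ map g (cartesianProduct xs ys))
    ≡⟨ sum-++ (map g (map (x ,_) ys)) _ ⟩
  sum (map g (map (x ,_) ys)) + sum (map g (cartesianProduct xs ys))
    ≡⟨ cong₂ _+_ (cong sum (sym (map-∘ ys))) (sum-product g xs ys) ⟩
  sum (map (λ y → g (x , y)) ys) + sum (map (λ x → sum (map (λ y → g (x , y)) ys)) xs) ∎
  where open ≡-Reasoning

length-filter-bits : ∀ k D → length (filter (λ a → bit a D ≟ 1) (upTo k)) ≡ popcount k D
length-filter-bits zero    D = refl
length-filter-bits (suc k) D = begin
  length (filter isOne? (0 ∷ applyUpTo suc k))        ≡⟨ cong (λ l → length (filter isOne? (0 ∷ l))) (map-applyUpTo id suc k) ⟨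
  length (filter isOne? (0 ∷ map suc (upTo k)))       ≡⟨ head (map suc (upTo k)) ⟩
  lsb D + length (filter isOne? (map suc (upTo k)))   ≡⟨ cong (lsb D +_) (length-filter-map isOne? suc (upTo k)) ⟩
  lsb D + length (filter (isOne? ∘ suc) (upTo k))     ≡⟨ cong (lsb D +_) (length-filter-bits k ⌊ D /2⌋) ⟩
  lsb D + popcount k ⌊ D /2⌋                          ∎
  where
  open ≡-Reasoning
  isOne? : ∀ a → Dec (bit a D ≡ 1)
  isOne? a = bit a D ≟ 1
  head : ∀ l → length (filter isOne? (0 ∷ l)) ≡ lsb D + length (filter isOne? l)
  head l with half-suc D
  ... | inj₁ (p , _) rewrite p = refl
  ... | inj₂ (p , _) rewrite p = refl

points : ∀ n d → List (Point n d)
points n zero    = [] ∷ []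
points n (suc d) = cartesianProductWith _∷_ (allFin n) (points n d)

∈-points : ∀ {n d} (x : Point n d) → x ∈ points n d
∈-points []       = here refl
∈-points (x ∷ xs) = ∈-cartesianProductWith⁺ _∷_ (∈-allFin x) (∈-points xs)

points-unique : ∀ n d → Unique (points n d)
points-unique n zero    = [] ∷ []
points-unique n (suc d) = Uniq.cartesianProductWith⁺ _∷_ Vec.∷-injective (Uniq.allFin⁺ n) (points-unique n d)

_≟ᵖ_ : ∀ {n d} → DecidableEquality (Point n d)
_≟ᵖ_ = Vec.≡-dec Fin._≟_

_⪯?_ : ∀ {n d} (x y : Point n d) → Dec (x ⪯ y)
x ⪯? y = Fin.all? λ i → toℕ (lookup x i) ≤? toℕ (lookup y i)

⪯-trans : ∀ {n d} (x y z : Point n d) → x ⪯ y → y ⪯ z → x ⪯ z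
⪯-trans x y z p q i = ≤-trans (p i) (q i)

shift? : ∀ {n d} i a (x y : Point n d) → Dec (Shift i a x y)
shift? i a x y = map′ (λ (p , q) → shift p q) (λ (shift p q) → p , q)
  ((_ ≟ _) ×-dec Fin.all? (λ j → ¬? (j Fin.≟ i) →-dec (lookup x j Fin.≟ lookup y j)))

2^-injective : ∀ {a b} → 2 ^ a ≡ 2 ^ b → a ≡ b
2^-injective {a} {b} eq = ≤-antisym (≮⇒≥ λ b<a → <⇒≢ (^-monoʳ-< 2 ≤-refl b<a) (sym eq))
                                    (≮⇒≥ λ a<b → <⇒≢ (^-monoʳ-< 2 ≤-refl a<b) eq)

module _ {n d : ℕ} where

  shift-unique : ∀ {i a j b} {x y : Point n d} → Shift i a x y → Shift j b x y → (i , a) ≡ (j , b)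
  shift-unique {i} {a} {j} {b} {x} {y} (shift p q) (shift p′ q′) with i Fin.≟ j
  ... | yes refl = cong (i ,_) (2^-injective (+-cancelˡ-≡ (toℕ (lookup x i)) _ _ (trans (sym p) p′)))
  ... | no i≢j   = contradiction (cong toℕ (q′ i i≢j)) (<⇒≢ (subst (toℕ (lookup x i) <_) (sym p) (m<m+n _ (m^n>0 2 a))))

  shift-exponent-< : ∀ {i a} {x y : Point n d} → Shift i a x y → a < n
  shift-exponent-< {i} {a} {x} {y} (shift p _) =
    <-≤-trans (n<2^n a) (≤-trans (≤-trans (m≤n+m _ (toℕ (lookup x i))) (≤-reflexive (sym p))) (<⇒≤ (Fin.toℕ<n (lookup y i))))

  shift-⪯⁺ : ∀ {i a} {x x′ y y′ : Point n d} → Shift i a x x′ → Shift i a y y′ → x ⪯ y → x′ ⪯ y′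
  shift-⪯⁺ {i} {a} (shift p q) (shift p′ q′) le j with j Fin.≟ i
  ... | yes refl = ≤-trans (≤-reflexive p) (≤-trans (+-monoˡ-≤ (2 ^ a) (le i)) (≤-reflexive (sym p′)))
  ... | no j≢i   = subst₂ (λ u v → toℕ u ≤ toℕ v) (q j j≢i) (q′ j j≢i) (le j)

  shift-⪯⁻ : ∀ {i a} {x x′ y y′ : Point n d} → Shift i a x x′ → Shift i a y y′ → x′ ⪯ y′ → x ⪯ y
  shift-⪯⁻ {i} {a} (shift p q) (shift p′ q′) le j with j Fin.≟ i
  ... | yes refl = +-cancelʳ-≤ (2 ^ a) _ _ (subst₂ _≤_ p p′ (le i))
  ... | no j≢i   = subst₂ (λ u v → toℕ u ≤ toℕ v) (sym (q j j≢i)) (sym (q′ j j≢i)) (le j)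

module Weights {n d : ℕ} (f : Point n d → Bool) where

  pts : List (Point n d)
  pts = points n d

  violated : ∀ {x y} → x ⪯ y → f x ≡ true → f y ≡ false → Violated f x y
  violated le fx fy = (le , λ { refl → contradiction (trans (sym fx) fy) λ () }) , fx , fy

  violated? : ∀ x y → Dec (Violated f x y)
  violated? x y = ((x ⪯? y) ×-dec ¬? (x ≟ᵖ y)) ×-dec ((f x Bool.≟ true) ×-dec (f y Bool.≟ false))

  -- `d * n` bounds every distance, so the weight is positive exactly on violated pairs, and closer
  -- pairs weigh more.
  weight : Point n d → Point n d → ℕ
  weight x y with violated? x y
  ... | yes _ = suc (d * n) ∸ dist x y
  ... | no _  = 0

  weight+dist : ∀ {x y} → Violated f x y → weight x y + dist x y ≡ suc (d * n)
  weight+dist {x} {y} v with violated? x y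
  ... | yes _ = m∸n+n≡m (m≤n⇒m≤1+n (dist-≤ x y))
  ... | no ¬v = contradiction v ¬v

  weight-positive : ∀ {x y} → Violated f x y → 0 < weight x y
  weight-positive {x} {y} v with violated? x y
  ... | yes _ = m<n⇒0<n∸m (s≤s (dist-≤ x y))
  ... | no ¬v = contradiction v ¬v

  weight-violated : ∀ {x y} → 0 < weight x y → Violated f x y
  weight-violated {x} {y} pos with violated? x y
  ... | yes v = v
  ... | no _  = contradiction pos λ ()

  open WeightedMatching _≟ᵖ_ pts ∈-points public

module Routing {n d : ℕ} (f : Point n d → Bool) (dual : Weights.DualPair f (Weights.weight f)) where

  open Weights f
  open DualPair dual

  mate-violated : ∀ {x y} → m y ≡ just x → Violated f x y
  mate-violated = weight-violated ∘ positive

  -- On violated pairs weight plus distance is constant. Tightness at the matched pair and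
  -- feasibility at the other pair therefore compare directly.
  exchange : ∀ {u v x y} → m v ≡ just u → Violated f x y →
    α u + β v + dist u v ≤ α x + β y + dist x y
  exchange {u} {v} {x} {y} eq viol = begin
    α u + β v + dist u v    ≡⟨ cong (_+ dist u v) (tight eq) ⟩
    weight u v + dist u v   ≡⟨ weight+dist (mate-violated eq) ⟩
    suc (d * n)             ≡⟨ weight+dist viol ⟨
    weight x y + dist x y   ≤⟨ +-monoˡ-≤ (dist x y) (covers x y) ⟩
    α x + β y + dist x y    ∎
    where open ≤-Reasoning

  Edge : Set
  Edge = (Fin d × ℕ) × Pair n d

  edges : List Edge
  edges = cartesianProduct (cartesianProduct (allFin d) (upTo n)) (cartesianProduct pts pts)

  edges-unique : Unique edges
  edges-unique = Uniq.cartesianProduct⁺ (Uniq.cartesianProduct⁺ (Uniq.allFin⁺ d) (Uniq.upTo⁺ n))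
    (Uniq.cartesianProduct⁺ (points-unique n d) (points-unique n d))

  ∈-edges : ∀ {i a x y} → Shift i a x y → ((i , a) , (x , y)) ∈ edges
  ∈-edges {i} {a} {x} {y} s = ∈-cartesianProduct⁺ (∈-cartesianProduct⁺ (∈-allFin i) (∈-upTo⁺ (shift-exponent-< s)))
    (∈-cartesianProduct⁺ (∈-points x) (∈-points y))

  -- An alternating walk through the matching and the shifts by 2 ^ a in direction i
  -- visits only rising and falling edges until it meets a violated one; counting
  -- these edges replaces following the walk.
  IsViolated IsRising IsFalling : Edge → Set
  IsViolated ((i , a) , (x , y)) = Shift i a x y × f x ≡ true × f y ≡ false
  IsRising   ((i , a) , (x , y)) = Shift i a x y × f x ≡ true × f y ≡ true × α x < α y
  IsFalling  ((i , a) , (x , y)) = Shift i a x y × f x ≡ false × f y ≡ false × β y < β x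

  isViolated? : Decidable IsViolated
  isViolated? ((i , a) , (x , y)) = shift? i a x y ×-dec ((f x Bool.≟ true) ×-dec (f y Bool.≟ false))

  isRising? : Decidable IsRising
  isRising? ((i , a) , (x , y)) = shift? i a x y ×-dec ((f x Bool.≟ true) ×-dec ((f y Bool.≟ true) ×-dec (α x <? α y)))

  isFalling? : Decidable IsFalling
  isFalling? ((i , a) , (x , y)) = shift? i a x y ×-dec ((f x Bool.≟ false) ×-dec ((f y Bool.≟ false) ×-dec (β y <? β x)))

  violatedEdges risingEdges fallingEdges : List Edge
  violatedEdges = filter isViolated? edges
  risingEdges   = filter isRising? edges
  fallingEdges  = filter isFalling? edges

  ∈-violatedEdges : ∀ {i a x y} → Shift i a x y → f x ≡ true → f y ≡ false → ((i , a) , (x , y)) ∈ violatedEdges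
  ∈-violatedEdges s fx fy = ∈-filter⁺ isViolated? (∈-edges s) (s , fx , fy)

  from-source : ∀ {i a x x′} → Shift i a x x′ → f x ≡ true → (f x′ ≡ true → α x < α x′) →
    ((i , a) , (x , x′)) ∈ risingEdges ++ violatedEdges
  from-source {x′ = x′} s fx rise with f x′ in fx′
  ... | true  = ∈-++⁺ˡ (∈-filter⁺ isRising? (∈-edges s) (s , fx , fx′ , rise refl))
  ... | false = ∈-++⁺ʳ risingEdges (∈-violatedEdges s fx fx′)

  from-target : ∀ {i a y y′} → Shift i a y y′ → f y′ ≡ false → (f y ≡ false → β y′ < β y) →
    ((i , a) , (y , y′)) ∈ fallingEdges ++ violatedEdges
  from-target {y = y} s fy′ fall with f y in fy
  ... | false = ∈-++⁺ˡ (∈-filter⁺ isFalling? (∈-edges s) (s , fy , fy′ , fall refl))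
  ... | true  = ∈-++⁺ʳ fallingEdges (∈-violatedEdges s fy fy′)

  -- The rise makes α positive at `x′`, so slackness gives a mate `y′`; let `y` be `y′` shifted
  -- back. If `f y` is false, then `(x , y)` is violated and as long as `(x′ , y′)`, so `exchange`
  -- turns the rise of α into a fall of β.
  rising-step : ∀ {i a x x′} → IsRising ((i , a) , (x , x′)) →
    ∃₂ λ y y′ → ((i , a) , (y , y′)) ∈ fallingEdges ++ violatedEdges × m y′ ≡ just x′
  rising-step {i} {a} {x} {x′} (s , fx , fx′ , α<)
    with y′ , eq ← α-matched (≤-<-trans z≤n α<)
    with (x′⪯y′ , _) , _ , fy′ ← mate-violated eq
    -- Shifting back is possible because coordinate `i` of `y′` is at least that of `x′`, hence at
    -- least `2 ^ a`.
    with y , s′ ← shift-down i a y′ (≤-trans (≤-trans (m≤n+m _ (toℕ (lookup x i))) (≤-reflexive (sym (Shift.at s)))) (x′⪯y′ i))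
    = y , y′ , from-target s′ fy′ fall , eq
    where
    fall : f y ≡ false → β y′ < β y
    fall fy = +-cancelˡ-< (α x) _ _ (<-≤-trans (+-monoˡ-< (β y′) α<) (+-cancelʳ-≤ (dist x y) _ _ (begin
      α x′ + β y′ + dist x y    ≡⟨ cong (α x′ + β y′ +_) (dist-shift s s′) ⟩
      α x′ + β y′ + dist x′ y′  ≤⟨ exchange eq (violated (shift-⪯⁻ s s′ x′⪯y′) fx fy) ⟩
      α x + β y + dist x y      ∎)))
      where open ≤-Reasoning

  -- The mirror image of `rising-step`: β is positive at `y`, its mate `x` is shifted up, and the
  -- fall of β forces a rise of α unless the new edge is violated. Room for the shift comes from
  -- `x ⪯ y` and the existence of `y′`.
  falling-step : ∀ {i a y y′} → IsFalling ((i , a) , (y , y′)) →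
    ∃₂ λ x x′ → ((i , a) , (x , x′)) ∈ risingEdges ++ violatedEdges × m y ≡ just x
  falling-step {i} {a} {y} {y′} (s , fy , fy′ , β<)
    with x , eq ← β-matched (≤-<-trans z≤n β<)
    with (x⪯y , _) , fx , _ ← mate-violated eq
    with x′ , s′ ← shift-up i a x (≤-<-trans (≤-trans (+-monoˡ-≤ (2 ^ a) (x⪯y i)) (≤-reflexive (sym (Shift.at s)))) (Fin.toℕ<n (lookup y′ i)))
    = x , x′ , from-source s′ fx rise , eq
    where
    rise : f x′ ≡ true → α x < α x′
    rise fx′ = +-cancelʳ-< (β y′) _ _ (<-≤-trans (+-monoʳ-< (α x) β<) (+-cancelʳ-≤ (dist x y) _ _ (begin
      α x + β y + dist x y      ≤⟨ exchange eq (violated (shift-⪯⁺ s′ s x⪯y) fx′ fy′) ⟩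
      α x′ + β y′ + dist x′ y′  ≡⟨ cong (α x′ + β y′ +_) (dist-shift s′ s) ⟨
      α x′ + β y′ + dist x y    ∎)))
      where open ≤-Reasoning

  -- Here the alternating walk starts: `(x′ , y)` is shorter by one than the matched pair, so if it
  -- is violated, `exchange` leaves α strictly larger at `x′`.
  crossing-step : ∀ {i a x y} → m y ≡ just x → a < n → bit a (gap x y i) ≡ 1 →
    ∃ λ x′ → ((i , a) , (x , x′)) ∈ risingEdges ++ violatedEdges
  crossing-step {i} {a} {x} {y} eq a<n b
    with (x⪯y , _) , fx , fy ← mate-violated eq
    with x′ , s , x′⪯y , dist≡ ← advance {i = i} {a} x y x⪯y a<n b
    = x′ , from-source s fx rise
    where
    rise : f x′ ≡ true → α x < α x′
    rise fx′ = +-cancelʳ-≤ (β y) _ _ (+-cancelʳ-≤ (dist x′ y) _ _ (begin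
      suc (α x + β y) + dist x′ y  ≡⟨ +-suc (α x + β y) _ ⟨
      α x + β y + suc (dist x′ y)  ≡⟨ cong (α x + β y +_) dist≡ ⟨
      α x + β y + dist x y         ≤⟨ exchange eq (violated x′⪯y fx′ fy) ⟩
      α x′ + β y + dist x′ y       ∎))
      where open ≤-Reasoning

  -- Adding 2 ^ a to a number whose bit a is set does not increase its popcount, so
  -- pushing y up is free; hence no alternating walk runs into a crossing pair.
  crossing-not-falling : ∀ {i a x y y′} → m y ≡ just x → bit a (gap x y i) ≡ 1 → ¬ IsFalling ((i , a) , (y , y′))
  crossing-not-falling {i} {a} {x} {y} {y′} eq b (s , fy , fy′ , β<)
    with (x⪯y , _) , fx , _ ← mate-violated eq = contradiction β≤ (<⇒≱ β<)
    where
    β≤ : β y ≤ β y′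
    β≤ = +-cancelˡ-≤ (α x) _ _ (+-cancelʳ-≤ (dist x y) _ _ (begin
      α x + β y + dist x y     ≤⟨ exchange eq (violated (⪯-trans x y y′ x⪯y (shift-⪯ s)) fx fy′) ⟩
      α x + β y′ + dist x y′   ≤⟨ +-monoʳ-≤ (α x + β y′) (dist-carry x s x⪯y b) ⟩
      α x + β y′ + dist x y    ∎))
      where open ≤-Reasoning

  matching : List (Pair n d)
  matching = filter (λ (x , y) → ≡-decᴹ _≟ᵖ_ (m y) (just x)) (cartesianProduct pts pts)

  ∈-matching⁺ : ∀ {x y} → m y ≡ just x → (x , y) ∈ matching
  ∈-matching⁺ {x} {y} = ∈-filter⁺ _ (∈-cartesianProduct⁺ (∈-points x) (∈-points y))

  ∈-matching⁻ : ∀ {p} → p ∈ matching → m (proj₂ p) ≡ just (proj₁ p)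
  ∈-matching⁻ p∈ = proj₂ (∈-filter⁻ (λ (x , y) → ≡-decᴹ _≟ᵖ_ (m y) (just x)) {xs = cartesianProduct pts pts} p∈)

  matching-unique : Unique matching
  matching-unique = Uniq.filter⁺ _ (Uniq.cartesianProduct⁺ (points-unique n d) (points-unique n d))

  -- A matched pair, a direction i and an exponent a with bit a of yᵢ − xᵢ set.
  Crossing : Set
  Crossing = (Pair n d × Fin d) × ℕ

  isOne? : Decidable {A = Crossing} (λ (((x , y) , i) , a) → bit a (gap x y i) ≡ 1)
  isOne? (((x , y) , i) , a) = bit a (gap x y i) ≟ 1

  crossings : List Crossing
  crossings = filter isOne? (cartesianProduct (cartesianProduct matching (allFin d)) (upTo n))

  crossings-unique : Unique crossings
  crossings-unique = Uniq.filter⁺ isOne? (Uniq.cartesianProduct⁺ (Uniq.cartesianProduct⁺ matching-unique (Uniq.allFin⁺ d)) (Uniq.upTo⁺ n))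

  ∈-crossings⁻ : ∀ {x y i a} → (((x , y) , i) , a) ∈ crossings → m y ≡ just x × a < n × bit a (gap x y i) ≡ 1
  ∈-crossings⁻ c∈ with c∈′ , b ← ∈-filter⁻ isOne? {xs = cartesianProduct (cartesianProduct matching (allFin d)) (upTo n)} c∈
    with pi∈ , a∈ ← ∈-cartesianProduct⁻ (cartesianProduct matching (allFin d)) (upTo n) c∈′
    with p∈ , _ ← ∈-cartesianProduct⁻ matching (allFin d) pi∈ = ∈-matching⁻ p∈ , ∈-upTo⁻ a∈ , b

  totalDist : ℕ
  totalDist = sum (map (λ (x , y) → dist x y) matching)

  -- For a fixed pair and direction the crossings are the set digits of the difference; summed over
  -- directions they give the distance of the pair.
  length-crossings : length crossings ≡ totalDist
  length-crossings = begin
    length crossings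
      ≡⟨ length-filter-product isOne? (cartesianProduct matching (allFin d)) (upTo n) ⟩
    sum (map (λ pi → length (filter (λ a → isOne? (pi , a)) (upTo n))) (cartesianProduct matching (allFin d)))
      ≡⟨ cong sum (map-cong (λ ((x , y) , i) → length-filter-bits n (gap x y i)) (cartesianProduct matching (allFin d))) ⟩
    sum (map (λ ((x , y) , i) → popcount n (gap x y i)) (cartesianProduct matching (allFin d)))
      ≡⟨ sum-product _ matching (allFin d) ⟩
    sum (map (λ (x , y) → sum (map (λ i → popcount n (gap x y i)) (allFin d))) matching)
      ≡⟨ cong sum (map-cong (λ (x , y) → cong sum (map-tabulate id (λ i → popcount n (gap x y i)))) matching) ⟩
    totalDist ∎
    where open ≡-Reasoning

  ∈-rising⁻ : ∀ {e} → e ∈ risingEdges → IsRising e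
  ∈-rising⁻ e∈ = proj₂ (∈-filter⁻ isRising? {xs = edges} e∈)

  ∈-falling⁻ : ∀ {e} → e ∈ fallingEdges → IsFalling e
  ∈-falling⁻ e∈ = proj₂ (∈-filter⁻ isFalling? {xs = edges} e∈)

  -- Send a rising edge along `rising-step`. The upper end `y′` of the image determines its mate
  -- `x′`, and `x′` shifted back determines the edge.
  rising-≤ : length risingEdges ≤ length fallingEdges + length violatedEdges
  rising-≤ = ≤-trans
    (length-≤-of-injective R (Uniq.filter⁺ isRising? edges-unique) total (λ {_} {_} {e′} → inj {e′ = e′}))
    (≤-reflexive (length-++ fallingEdges))
    where
    R : Edge → Edge → Set
    R (ia , (_ , x′)) (jb , (_ , y′)) = ia ≡ jb × m y′ ≡ just x′
    total : ∀ {e} → e ∈ risingEdges → ∃ λ e′ → e′ ∈ fallingEdges ++ violatedEdges × R e e′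
    total e∈ with y , y′ , e′∈ , eq ← rising-step (∈-rising⁻ e∈) = _ , e′∈ , refl , eq
    inj : ∀ {e e₁ e′} → e ∈ risingEdges → e₁ ∈ risingEdges → R e e′ → R e₁ e′ → e ≡ e₁
    inj e∈ e₁∈ (refl , eq) (refl , eq₁) with refl ← just-injective (trans (sym eq) eq₁)
      with s , _ ← ∈-rising⁻ e∈ | s₁ , _ ← ∈-rising⁻ e₁∈ with refl ← shift-injective s s₁ = refl

  -- Crossings and falling edges are sent jointly along `crossing-step` and `falling-step`, both
  -- remembering the source `u` of the image. Since `u` has only one mate, the image determines the
  -- target from which it came.
  crossing+falling-≤ : length crossings + length fallingEdges ≤ length risingEdges + length violatedEdges
  crossing+falling-≤ = begin
    length crossings + length fallingEdges        ≡⟨ cong₂ _+_ (length-map inj₁ crossings) (length-map inj₂ fallingEdges) ⟨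
    length lefts + length rights                  ≡⟨ length-++ lefts ⟨
    length (lefts ++ rights)                      ≤⟨ length-≤-of-injective R uniq total inj ⟩
    length (risingEdges ++ violatedEdges)         ≡⟨ length-++ risingEdges ⟩
    length risingEdges + length violatedEdges     ∎
    where
    open ≤-Reasoning
    lefts rights : List (Crossing ⊎ Edge)
    lefts  = map inj₁ crossings
    rights = map inj₂ fallingEdges
    R : Crossing ⊎ Edge → Edge → Set
    R (inj₁ (((x , y) , i) , a)) (jb , (u , _)) = (i , a) ≡ jb × x ≡ u
    R (inj₂ (ia , (y , _)))      (jb , (u , _)) = ia ≡ jb × m y ≡ just u
    uniq : Unique (lefts ++ rights)
    uniq = Uniq.++⁺ (Uniq.map⁺ inj₁-injective crossings-unique)
      (Uniq.map⁺ inj₂-injective (Uniq.filter⁺ isFalling? edges-unique))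
      λ (p , q) → disjoint (∈-map⁻ inj₁ p) (∈-map⁻ inj₂ q)
      where
      disjoint : ∀ {v : Crossing ⊎ Edge} → ∃ (λ c → c ∈ crossings × v ≡ inj₁ c) → ∃ (λ e → e ∈ fallingEdges × v ≡ inj₂ e) → ⊥
      disjoint (_ , _ , refl) (_ , _ , ())
    source : ∀ {v} → v ∈ lefts ++ rights → (∃ λ c → c ∈ crossings × v ≡ inj₁ c) ⊎ (∃ λ e → e ∈ fallingEdges × v ≡ inj₂ e)
    source v∈ with ∈-++⁻ lefts v∈
    ... | inj₁ p = inj₁ (∈-map⁻ inj₁ p)
    ... | inj₂ p = inj₂ (∈-map⁻ inj₂ p)
    total : ∀ {v} → v ∈ lefts ++ rights → ∃ λ e → e ∈ risingEdges ++ violatedEdges × R v e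
    total v∈ with source v∈
    ... | inj₁ (c@(((x , y) , i) , a) , c∈ , refl) with eq , a<n , b ← ∈-crossings⁻ c∈
      with x′ , e∈ ← crossing-step {i} {a} {x} {y} eq a<n b = _ , e∈ , refl , refl
    ... | inj₂ (e , e∈ , refl) with x , x′ , e′∈ , eq ← falling-step (∈-falling⁻ e∈) = _ , e′∈ , refl , eq
    -- A shared image would put a crossing and a falling edge of the same direction and exponent at
    -- one matched target, against `crossing-not-falling`.
    clash : ∀ {x y i a jb e z} → (((x , y) , i) , a) ∈ crossings → (jb , (z , e)) ∈ fallingEdges →
      (i , a) ≡ jb → m z ≡ just x → ⊥
    clash c∈ e∈ refl eq′ with eq , _ , b ← ∈-crossings⁻ c∈ with refl ← m-inj eq eq′ =
      crossing-not-falling eq b (∈-falling⁻ e∈)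
    inj : ∀ {v v₁ e} → v ∈ lefts ++ rights → v₁ ∈ lefts ++ rights → R v e → R v₁ e → v ≡ v₁
    inj v∈ v₁∈ Rv Rv₁ with source v∈ | source v₁∈
    inj _ _ (refl , refl) (refl , refl) | inj₁ (_ , c∈ , refl) | inj₁ (_ , c₁∈ , refl)
      with eq , _ ← ∈-crossings⁻ c∈ | eq₁ , _ ← ∈-crossings⁻ c₁∈ with refl ← m-inj eq eq₁ = refl
    inj _ _ (refl , refl) (refl , eq) | inj₁ (_ , c∈ , refl) | inj₂ (_ , e∈ , refl) = ⊥-elim (clash c∈ e∈ refl eq)
    inj _ _ (refl , eq) (refl , refl) | inj₂ (_ , e∈ , refl) | inj₁ (_ , c∈ , refl) = ⊥-elim (clash c∈ e∈ refl eq)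
    inj _ _ (refl , eq) (refl , eq₁) | inj₂ (_ , e∈ , refl) | inj₂ (_ , e₁∈ , refl)
      with refl ← m-inj eq eq₁ with s , _ ← ∈-falling⁻ e∈ | s₁ , _ ← ∈-falling⁻ e₁∈
      with refl ← shift-functional s s₁ = refl

  -- Chaining the two counts cancels the falling edges. The factor two arises because a violated
  -- edge can end one walk that enters through a source and another that enters through a target.
  totalDist-≤-violatedEdges : totalDist ≤ 2 * length violatedEdges
  totalDist-≤-violatedEdges = +-cancelʳ-≤ (length fallingEdges) _ _ (begin
    totalDist + F               ≡⟨ cong (_+ F) length-crossings ⟨
    length crossings + F        ≤⟨ crossing+falling-≤ ⟩
    length risingEdges + V      ≤⟨ +-monoˡ-≤ V rising-≤ ⟩
    F + V + V                   ≡⟨ +-assoc F V V ⟩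
    F + (V + V)                 ≡⟨ +-comm F (V + V) ⟩
    V + V + F                   ≡⟨ cong (λ k → V + k + F) (+-identityʳ V) ⟨
    2 * V + F                   ∎)
    where
    open ≤-Reasoning
    F = length fallingEdges
    V = length violatedEdges

  -- Forgetting direction and exponent is injective, as an edge determines both by `shift-unique`.
  totalDist-≤ : ∀ {s} → HasSize (InSminus f) s → totalDist ≤ 2 * s
  totalDist-≤ {s} (S , _ , _ , S-complete , len) = ≤-trans totalDist-≤-violatedEdges (*-monoʳ-≤ 2 (≤-trans
    (length-≤-of-injective R (Uniq.filter⁺ isViolated? edges-unique) total inj) (≤-reflexive len)))
    where
    R : Edge → Pair n d → Set
    R e p = proj₂ e ≡ p
    ∈-violated⁻ : ∀ {e} → e ∈ violatedEdges → IsViolated e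
    ∈-violated⁻ e∈ = proj₂ (∈-filter⁻ isViolated? {xs = edges} e∈)
    total : ∀ {e} → e ∈ violatedEdges → ∃ λ p → p ∈ S × R e p
    total {(i , a) , p} e∈ with shift at off , fx , fy ← ∈-violated⁻ e∈ = p , S-complete p ((i , a , at , off) , fx , fy) , refl
    inj : ∀ {e e₁ p} → e ∈ violatedEdges → e₁ ∈ violatedEdges → R e p → R e₁ p → e ≡ e₁
    inj e∈ e₁∈ refl refl with s , _ ← ∈-violated⁻ e∈ | s₁ , _ ← ∈-violated⁻ e₁∈ with refl ← shift-unique s s₁ = refl

-- Maximality, vertex covers and the distance to monotonicity

module _ {n d : ℕ} where

  ∈-endpoints⁻ : ∀ (L : List (Pair n d)) {z} → z ∈ endpoints L → ∃ λ p → p ∈ L × (z ≡ proj₁ p ⊎ z ≡ proj₂ p)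
  ∈-endpoints⁻ ((x , y) ∷ L) (here refl)         = _ , here refl , inj₁ refl
  ∈-endpoints⁻ ((x , y) ∷ L) (there (here refl)) = _ , here refl , inj₂ refl
  ∈-endpoints⁻ ((x , y) ∷ L) (there (there z∈)) with p , p∈ , eq ← ∈-endpoints⁻ L z∈ = p , there p∈ , eq

  ∈-endpoints₁ : ∀ {L : List (Pair n d)} {x y} → (x , y) ∈ L → x ∈ endpoints L
  ∈-endpoints₁ (here refl) = here refl
  ∈-endpoints₁ (there p∈)  = there (there (∈-endpoints₁ p∈))

  ∈-endpoints₂ : ∀ {L : List (Pair n d)} {x y} → (x , y) ∈ L → y ∈ endpoints L
  ∈-endpoints₂ (here refl) = there (here refl)
  ∈-endpoints₂ (there p∈)  = there (there (∈-endpoints₂ p∈))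

  length-endpoints : ∀ (L : List (Pair n d)) → length (endpoints L) ≡ 2 * length L
  length-endpoints []      = refl
  length-endpoints (p ∷ L) = trans (cong (suc ∘ suc) (length-endpoints L)) (sym (*-suc 2 (length L)))

  -- A left end never equals a right end because `f` separates them; repetitions on one side are
  -- excluded by the two injectivity hypotheses.
  endpoints-unique : (f : Point n d → Bool) → ∀ {L} → Unique L →
    (∀ {p} → p ∈ L → f (proj₁ p) ≡ true × f (proj₂ p) ≡ false) →
    (∀ {p q} → p ∈ L → q ∈ L → proj₁ p ≡ proj₁ q → p ≡ q) →
    (∀ {p q} → p ∈ L → q ∈ L → proj₂ p ≡ proj₂ q → p ≡ q) →
    Unique (endpoints L)
  endpoints-unique f {[]} [] _ _ _ = []
  endpoints-unique f {(x , y) ∷ L} (p∉ ∷ uniq) bip inj₁ᴸ inj₂ᴸ =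
    ((λ { refl → clash (trans (sym fx) fy) }) ∷ All.tabulate (λ z∈ eq → x-fresh (∈-endpoints⁻ L z∈) eq)) ∷
    All.tabulate (λ z∈ eq → y-fresh (∈-endpoints⁻ L z∈) eq) ∷
    endpoints-unique f uniq (bip ∘ there) (λ p q → inj₁ᴸ (there p) (there q)) (λ p q → inj₂ᴸ (there p) (there q))
    where
    clash : true ≢ false
    clash ()
    fx = proj₁ (bip (here refl))
    fy = proj₂ (bip (here refl))
    x-fresh : ∀ {z} → (∃ λ p → p ∈ L × (z ≡ proj₁ p ⊎ z ≡ proj₂ p)) → x ≢ z
    x-fresh (p , p∈ , inj₁ refl) eq = All.lookup p∉ p∈ (inj₁ᴸ (here refl) (there p∈) eq)
    x-fresh (p , p∈ , inj₂ refl) eq = clash (trans (sym fx) (trans (cong f eq) (proj₂ (bip (there p∈)))))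
    y-fresh : ∀ {z} → (∃ λ p → p ∈ L × (z ≡ proj₁ p ⊎ z ≡ proj₂ p)) → y ≢ z
    y-fresh (p , p∈ , inj₁ refl) eq = clash (trans (sym (proj₁ (bip (there p∈)))) (trans (cong f (sym eq)) fy))
    y-fresh (p , p∈ , inj₂ refl) eq = All.lookup p∉ p∈ (inj₂ᴸ (here refl) (there p∈) eq)

  module _ (f : Point n d → Bool) where

    Cover : List (Point n d) → Set
    Cover C = ∀ {x y} → Violated f x y → x ∈ C ⊎ y ∈ C

    module _ (C : List (Point n d)) where

      open DecMembership (_≟ᵖ_ {n} {d}) using (_∈?_)

      Raised : Point n d → Point n d → Set
      Raised x u = u ⪯ x × f u ≡ true × u ∉ C

      raised? : ∀ x → Dec (Any (Raised x) (points n d))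
      raised? x = Any.any? (λ u → (u ⪯? x) ×-dec ((f u Bool.≟ true) ×-dec ¬? (u ∈? C))) (points n d)

      -- The least monotone function that is true at every point outside `C` where `f` is true.
      repair : Point n d → Bool
      repair x = does (raised? x)

      repair-monotone : Monotone repair
      repair-monotone x y x⪯y with raised? x
      ... | no _ = f≤any (does (raised? y))
        where
        f≤any : ∀ b → false Bool.≤ b
        f≤any false = b≤b
        f≤any true  = f≤t
      ... | yes r = subst (true Bool.≤_) (sym (dec-true (raised? y)
        (Any.map (λ {u} (u⪯x , fu , u∉) → ⪯-trans u x y u⪯x x⪯y , fu , u∉) r))) b≤b

      -- If `f` is false at `x` but `repair` is true, some true point of `f` outside `C` lies below
      -- `x`, and the two form a violated pair that the cover misses.
      repair-agrees : Cover C → ∀ {x} → x ∉ C → f x ≡ repair x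
      repair-agrees cover {x} x∉ with f x in fx
      ... | true  = sym (dec-true (raised? x) (lose (∈-points x) ((λ _ → ≤-refl) , fx , x∉)))
      ... | false = sym (dec-false (raised? x) λ r → none (find r))
        where
        none : ¬ (∃ λ u → u ∈ points n d × Raised x u)
        none (u , _ , u⪯x , fu , u∉) with cover (Weights.violated f u⪯x fu fx)
        ... | inj₁ u∈ = u∉ u∈
        ... | inj₂ x∈ = x∉ x∈

      far-≤-cover : Cover C → ∀ {ε} → Far ε f → ∃ λ k → k ≤ length C × ε ℚ.* toℚ (n ^ d) ℚ.≤ toℚ k
      far-≤-cover cover far = length disagreements , length-≤-of-⊆ uniq inC , far repair repair-monotone _
        (disagreements , uniq , (λ x x∈ → proj₂ (∈-filter⁻ differ? {xs = points n d} x∈)) , (λ x → ∈-filter⁺ differ? (∈-points x)) , refl)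
        where
        differ? : ∀ x → Dec (f x ≢ repair x)
        differ? x = ¬? (f x Bool.≟ repair x)
        disagreements : List (Point n d)
        disagreements = filter differ? (points n d)
        uniq : Unique disagreements
        uniq = Uniq.filter⁺ differ? (points-unique n d)
        inC : ∀ {x} → x ∈ disagreements → x ∈ C
        inC {x} x∈ = decidable-stable (x ∈? C) λ x∉ →
          proj₂ (∈-filter⁻ differ? {xs = points n d} x∈) (repair-agrees cover x∉)

module Maximality {n d : ℕ} (f : Point n d → Bool) (dual : Weights.DualPair f (Weights.weight f)) where

  open Weights f
  open DualPair dual
  open Routing f dual

  -- The weight of a violated pair is positive, so feasibility makes α or β positive at one of its
  -- ends, and slackness says that this end is matched.
  matching-covers : ∀ {x y} → Violated f x y → (∃ λ z → (x , z) ∈ matching) ⊎ (∃ λ z → (z , y) ∈ matching)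
  matching-covers {x} {y} v with 0 <? α x
  ... | yes pos with z , eq ← α-matched pos = inj₁ (z , ∈-matching⁺ eq)
  ... | no ¬pos with z , eq ← β-matched (<-≤-trans (weight-positive v)
    (≤-trans (covers x y) (≤-reflexive (cong (_+ β y) (n≤0⇒n≡0 (≮⇒≥ ¬pos)))))) = inj₂ (z , ∈-matching⁺ eq)

  matching-maximal : MaximalMatching f matching
  matching-maximal = (λ p p∈ → mate-violated (∈-matching⁻ p∈)) ,
    endpoints-unique f matching-unique (λ p∈ → proj₂ (mate-violated (∈-matching⁻ p∈))) same-source same-target ,
    λ x y v → touch (matching-covers v)
    where
    same-source : ∀ {p q} → p ∈ matching → q ∈ matching → proj₁ p ≡ proj₁ q → p ≡ q
    same-source p∈ q∈ refl = cong (_ ,_) (m-inj (∈-matching⁻ p∈) (∈-matching⁻ q∈))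
    same-target : ∀ {p q} → p ∈ matching → q ∈ matching → proj₂ p ≡ proj₂ q → p ≡ q
    same-target p∈ q∈ refl = cong (_, _) (just-injective (trans (sym (∈-matching⁻ p∈)) (∈-matching⁻ q∈)))
    touch : ∀ {x y} → (∃ λ z → (x , z) ∈ matching) ⊎ (∃ λ z → (z , y) ∈ matching) → Any _ matching
    touch (inj₁ (z , p∈)) = Any.map (λ { refl → inj₁ refl }) p∈
    touch (inj₂ (z , p∈)) = Any.map (λ { refl → inj₂ (inj₂ (inj₂ refl)) }) p∈

  matching-cover : Cover f (endpoints matching)
  matching-cover v with matching-covers v
  ... | inj₁ (_ , p∈) = inj₁ (∈-endpoints₁ p∈)
  ... | inj₂ (_ , p∈) = inj₂ (∈-endpoints₂ p∈)

  matching-dists : ∀ L → (∀ {p} → p ∈ L → p ∈ matching) →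
    Pointwise (λ p k → IsDistA (proj₁ p) (proj₂ p) k) L (map (λ (x , y) → dist x y) L)
  matching-dists []            sub = []
  matching-dists ((x , y) ∷ L) sub =
    dist-isDistA x y (proj₁ (proj₁ (mate-violated (∈-matching⁻ (sub (here refl)))))) ∷ matching-dists L (sub ∘ there)

-- Rational arithmetic and the final averaging

toℚᵘ-toℚ : ∀ k → ℚ.toℚᵘ (toℚ k) ℚᵘ.≃ ℚᵘ.mkℚᵘ (ℤ.+ k) 0
toℚᵘ-toℚ k = ℚ.toℚᵘ-fromℚᵘ (ℚᵘ.mkℚᵘ (ℤ.+ k) 0)

toℚ-mono : ∀ {a b} → a ≤ b → toℚ a ℚ.≤ toℚ b
toℚ-mono {a} {b} a≤b = ℚ.toℚᵘ-cancel-≤ (begin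
  ℚ.toℚᵘ (toℚ a)     ≃⟨ toℚᵘ-toℚ a ⟩
  ℚᵘ.mkℚᵘ (ℤ.+ a) 0    ≤⟨ ℚᵘ.*≤* (subst₂ ℤ._≤_ (sym (ℤ.*-identityʳ (ℤ.+ a))) (sym (ℤ.*-identityʳ (ℤ.+ b))) (+≤+ a≤b)) ⟩
  ℚᵘ.mkℚᵘ (ℤ.+ b) 0    ≃⟨ toℚᵘ-toℚ b ⟨
  ℚ.toℚᵘ (toℚ b)     ∎)
  where open ℚᵘ.≤-Reasoning

toℚ-* : ∀ a b → toℚ (a * b) ≡ toℚ a ℚ.* toℚ b
toℚ-* a b = ℚ.toℚᵘ-injective (begin
  ℚ.toℚᵘ (toℚ (a * b))                     ≈⟨ toℚᵘ-toℚ (a * b) ⟩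
  ℚᵘ.mkℚᵘ (ℤ.+ (a * b)) 0                    ≈⟨ ℚᵘ.*≡* (cong (ℤ._* ℤ.+ 1) (ℤ.pos-* a b)) ⟩
  ℚᵘ.mkℚᵘ (ℤ.+ a) 0 ℚᵘ.* ℚᵘ.mkℚᵘ (ℤ.+ b) 0     ≈⟨ ℚᵘ.*-cong (toℚᵘ-toℚ a) (toℚᵘ-toℚ b) ⟨
  ℚ.toℚᵘ (toℚ a) ℚᵘ.* ℚ.toℚᵘ (toℚ b)       ≈⟨ ℚ.toℚᵘ-homo-* (toℚ a) (toℚ b) ⟨
  ℚ.toℚᵘ (toℚ a ℚ.* toℚ b)                 ∎)
  where open import Relation.Binary.Reasoning.Setoid ℚᵘ.≃-setoid

toℚ-pos : ∀ {k} → 1 ≤ k → ℚ.Positive (toℚ k)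
toℚ-pos {suc k} _ = ℚ.normalize-pos (suc k) 1

average : ∀ S {m} → 1 ≤ m → ∃ λ q → q ℚ.* toℚ m ≡ toℚ S
average S {m} 1≤m = toℚ S ℚ.* (ℚ.1/ toℚ m) , (begin
  toℚ S ℚ.* (ℚ.1/ toℚ m) ℚ.* toℚ m    ≡⟨ ℚ.*-assoc (toℚ S) _ _ ⟩
  toℚ S ℚ.* ((ℚ.1/ toℚ m) ℚ.* toℚ m)  ≡⟨ cong (toℚ S ℚ.*_) (ℚ.*-inverseˡ (toℚ m)) ⟩
  toℚ S ℚ.* 1ℚ                        ≡⟨ ℚ.*-identityʳ (toℚ S) ⟩
  toℚ S                               ∎)
  where
  open ≡-Reasoning
  instance
    _ : ℚ.NonZero (toℚ m)
    _ = ℚ.pos⇒nonZero (toℚ m) {{toℚ-pos 1≤m}}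

¼ : ℚ
¼ = ℤ.+ 1 ℚ./ 4

-- Each of the two factors two, from cover size and from total distance, costs one half; together
-- they give the constant ¼. Nonnegativity of `r` permits multiplying the bound on `ε N` by it.
combine : ∀ {r q ε N : ℚ} {m k S s : ℕ} → ℚ.NonNegative r →
  ε ℚ.* N ℚ.≤ toℚ k → k ≤ 2 * m → r ℚ.≤ q → q ℚ.* toℚ m ≡ toℚ S → S ≤ 2 * s →
  ¼ ℚ.* r ℚ.* ε ℚ.* N ℚ.≤ toℚ s
combine {r} {q} {ε} {N} {m} {k} {S} {s} r≥0 εN≤k k≤2m r≤q qm≡S S≤2s = begin
  ¼ ℚ.* r ℚ.* ε ℚ.* N                 ≡⟨ solve 3 (λ r ε N → con ¼ :* r :* ε :* N := con ¼ :* (r :* (ε :* N))) refl r ε N ⟩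
  ¼ ℚ.* (r ℚ.* (ε ℚ.* N))             ≤⟨ ℚ.*-monoˡ-≤-nonNeg ¼ (ℚ.*-monoˡ-≤-nonNeg r {{r≥0}} (ℚ.≤-trans εN≤k (toℚ-mono k≤2m))) ⟩
  ¼ ℚ.* (r ℚ.* toℚ (2 * m))           ≡⟨ cong (λ t → ¼ ℚ.* (r ℚ.* t)) (toℚ-* 2 m) ⟩
  ¼ ℚ.* (r ℚ.* (toℚ 2 ℚ.* toℚ m))     ≡⟨ solve 2 (λ r m → con ¼ :* (r :* (con (toℚ 2) :* m)) := con ½ :* (r :* m)) refl r (toℚ m) ⟩
  ½ ℚ.* (r ℚ.* toℚ m)                 ≤⟨ ℚ.*-monoˡ-≤-nonNeg ½ (ℚ.*-monoʳ-≤-nonNeg (toℚ m) {{ℚ.normalize-nonNeg m 1}} r≤q) ⟩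
  ½ ℚ.* (q ℚ.* toℚ m)                 ≡⟨ cong (½ ℚ.*_) qm≡S ⟩
  ½ ℚ.* toℚ S                         ≤⟨ ℚ.*-monoˡ-≤-nonNeg ½ (toℚ-mono S≤2s) ⟩
  ½ ℚ.* toℚ (2 * s)                   ≡⟨ cong (½ ℚ.*_) (toℚ-* 2 s) ⟩
  ½ ℚ.* (toℚ 2 ℚ.* toℚ s)             ≡⟨ solve 1 (λ s → con ½ :* (con (toℚ 2) :* s) := s) refl (toℚ s) ⟩
  toℚ s                               ∎
  where
  open ℚ.≤-Reasoning
  open +-*-Solver

avgDist-nonNegative : ∀ {n d} {M : List (Pair n d)} {r} → AvgDist M r → ℚ.NonNegative r
avgDist-nonNegative {M = M} {r} (1≤m , ds , _ , eq) = ℚ.nonNegative {r} (ℚ.*-cancelʳ-≤-pos (toℚ (length M)) {{toℚ-pos 1≤m}} (begin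
  0ℚ ℚ.* toℚ (length M)   ≡⟨ ℚ.*-zeroˡ (toℚ (length M)) ⟩
  toℚ 0                   ≤⟨ toℚ-mono {0} {sum ds} z≤n ⟩
  toℚ (sum ds)            ≡⟨ eq ⟨
  r ℚ.* toℚ (length M)    ∎))
  where open ℚ.≤-Reasoning

theorem2p2 : ∃[ c ] (0ℚ ℚ.< c × (∀ (n d : ℕ) → PowerOfTwo n → (f : Point n d → Bool) → (ε : ℚ) → Far ε f → (r : ℚ) → IsMinAvgDist f r → (s : ℕ) → HasSize (InSminus f) s → c ℚ.* r ℚ.* ε ℚ.* toℚ (n ^ d) ℚ.≤ toℚ s))
theorem2p2 = ¼ , ℚ.positive⁻¹ ¼ , λ n d _ f ε far r ((M , (M-violated , _) , avg) , minimal) s size →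
  bound f (Weights.egerváry f (Weights.weight f)) {ε} far {r} {M} M-violated avg minimal {s} size
  where
  bound : ∀ {n d} (f : Point n d → Bool) → Weights.DualPair f (Weights.weight f) → ∀ {ε} → Far ε f → ∀ {r M} →
    (∀ p → p ∈ M → Violated f (proj₁ p) (proj₂ p)) → AvgDist M r →
    (∀ M q → MaximalMatching f M → AvgDist M q → r ℚ.≤ q) → ∀ {s} → HasSize (InSminus f) s →
    ¼ ℚ.* r ℚ.* ε ℚ.* toℚ (n ^ d) ℚ.≤ toℚ s
  bound f dual {ε} far {r} {M} M-violated avg minimal {s} size =
    let q , qm≡S       = average totalDist nonempty
        k , k≤ , εN≤k  = far-≤-cover f (endpoints matching) matching-cover {ε} far
    in combine {r} {q} {ε} {m = length matching} {k} {totalDist} {s} (avgDist-nonNegative {M = M} {r} avg) εN≤k (≤-trans k≤ (≤-reflexive (length-endpoints matching)))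
         -- Minimality of `r` enters here: `r` is at most the average distance of the matching built
         -- from the dual pair.
         (minimal matching q matching-maximal (nonempty , _ , matching-dists matching id , qm≡S)) qm≡S (totalDist-≤ size)
    where
    open Routing f dual
    open Maximality f dual
    ∈⇒1≤length : ∀ {A : Set} {x : A} {xs} → x ∈ xs → 1 ≤ length xs
    ∈⇒1≤length (here _)  = s≤s z≤n
    ∈⇒1≤length (there _) = s≤s z≤n
    -- The matching attaining `r` has a pair, hence a violated pair exists, and `matching-covers`
    -- then finds a pair of `matching`.
    nonempty : 1 ≤ length matching
    nonempty = pick M M-violated (proj₁ avg)
      where
      pick : ∀ M → (∀ p → p ∈ M → Violated f (proj₁ p) (proj₂ p)) → 1 ≤ length M → 1 ≤ length matching
      pick (p ∷ _) viol _ with matching-covers (viol p (here refl))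
      ... | inj₁ (_ , p∈) = ∈⇒1≤length p∈
      ... | inj₂ (_ , p∈) = ∈⇒1≤length p∈
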